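{- There is a deterministic, constructive algorithm which, given a ground set $V$ of $n$ elements and access to the rank oracle of an unknown partition matroid on $V$ (with unknown partition $\mathcal{P}=(P_1,\ldots,P_k)$ and unknown capacities $r_1,\ldots,r_k$), outputs the partition $\mathcal{P}$ and the integers $r_1,\ldots,r_k$ using $O(n+k\log r)$ rank queries, where $r:=\mathsf{rank}(V)=\sum_{i=1}^k r_i$.
   Context: Let $V$ be a set of $n$ elements, $\mathcal{P}=(P_1,\ldots,P_k)$ an unknown partition of $V$ into nonempty parts, and $r_1,\ldots,r_k$ unknown integers with $1\le r_i<|P_i|$ for each $i$. These define the partition matroid on $V$ in which $I\subseteq V$ is independent iff $|I\cap P_i|\le r_i$ for all $i$. A rank query takes any $S\subseteq V$ and returns $\mathsf{rank}(S)=\sum_{i=1}^k\min(|S\cap P_i|,r_i)$. Queries may be adaptive; logarithms are base $2$. -}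

module Defs where

open import Data.Nat using (ℕ; zero; suc; _+_; _⊔_; _≤_; _<_)
open import Data.Bool using (Bool)
open import Data.Fin using (Fin; _≟_)
open import Data.Fin.Subset using (Subset; _∩_; ∣_∣)
open import Data.Vec using (Vec; tabulate; sum)
open import Data.Nat using (_⊓_)
open import Data.Product using (Σ; _×_; _,_; proj₁; proj₂)
open import Relation.Nullary.Decidable using (⌊_⌋)

Part : ∀ {n k} → (Fin n → Fin k) → Fin k → Subset n
Part p i = tabulate (λ x → ⌊ p x ≟ i ⌋)

rank : ∀ {n k} → (Fin n → Fin k) → (Fin k → ℕ) → Subset n → ℕ
rank {k = k} p r S = sum (tabulate {n = k} (λ i → ∣ S ∩ Part p i ∣ ⊓ r i))

-- Valid partition-matroid data: capacities satisfy 1 ≤ r_i < |P_i|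
-- (which in particular forces every part to be nonempty).
ValidCaps : ∀ {n k} → (Fin n → Fin k) → (Fin k → ℕ) → Set
ValidCaps {k = k} p r = (i : Fin k) → (1 ≤ r i) × (r i < ∣ Part p i ∣)

-- Adaptive deterministic query algorithms: decision trees whose internal
-- nodes ask a rank query on a subset and branch on the (natural-number) answer.
data Alg (n : ℕ) (Out : Set) : Set where
  done : Out → Alg n Out
  ask  : Subset n → (ℕ → Alg n Out) → Alg n Out

run : ∀ {n Out} → Alg n Out → (Subset n → ℕ) → Out × ℕ
run (done o) f = o , 0
run (ask S k) f with run (k (f S)) f
... | o , c = o , suc c

Output : ℕ → Set
Output n = Σ ℕ (λ k' → (Fin n → Fin k') × (Fin k' → ℕ))

{-# OPTIONS --safe #-}
module Submission where

-- Greedily find a basis B, then, by binary search, elements X of B and Y outside B forming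
-- transversals of the parts.  Contracting B ∖ X, respectively deleting everything but
-- B ∪ Y and dualising, leaves two partition matroids of capacity 1, in which a query
-- counts the classes met.  For independent T and Q such a query weighs T: it
-- counts the x ∈ T whose class meets Q.  So coin weighing finds all such x with
-- O(|T| / log |T|) queries.  Merging known partitions of small blocks into partitions
-- of larger blocks, with block sizes squared at every level, then costs O(n) in total.

open import Defs
open import Data.Nat using (ℕ; _+_; _*_; _≤_)
open import Data.Nat.Logarithm using (⌈log₂_⌉)
open import Data.Fin using (Fin)
open import Data.Fin.Subset using (⊤)
open import Data.Product using (Σ; _×_; _,_; proj₁; proj₂)
open import Function.Bundles using (_↔_; Inverse)
open import Relation.Binary.PropositionalEquality using (_≡_)

open import Data.Bool using (Bool; true; false; not; _∧_; T; if_then_else_)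
open import Data.Bool.Properties using (not-involutive)
open import Data.Empty using (⊥-elim)
open import Data.Fin using (zero; suc; _≟_)
open import Data.Fin.Properties using (all?)
open import Data.Fin.Subset using (Subset; ∣_∣; _∩_)
open import Data.Fin.Subset.Properties using (∩-identityˡ)
open import Data.List using (List; []; _∷_; _++_; map; length; mapMaybe; catMaybes; filterᵇ; take; drop; concat; head; zipWith; allFin; tabulate; lookup)
open import Data.List.Membership.Propositional using (_∈_)
open import Data.List.Membership.Propositional.Properties using (∈-++⁺ˡ; ∈-++⁺ʳ; ∈-++⁻; ∈-lookup)
open import Data.List.Properties using (length-map; length-++; length-take; length-drop; length-tabulate; map-++; map-∘; catMaybes-++; map-catMaybes; mapMaybe-cong; take++drop≡id; ++-assoc; ++-identityʳ)
open import Data.List.Relation.Unary.All using (All; []; _∷_)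
open import Data.List.Relation.Unary.Any using (here; there; any?; index)
open import Data.List.Relation.Unary.Any.Properties using (lookup-index)
open import Data.Maybe using (Maybe; just; nothing; maybe)
import Data.Maybe as Maybe
open import Data.Nat using (zero; suc; _<_; _∸_; _⊓_; _^_; z≤n; s≤s; _<ᵇ_; _≡ᵇ_; ⌊_/2⌋; ⌈_/2⌉; _≤?_)
open import Data.Nat.Induction using (<-rec)
open import Data.Nat.Logarithm using (⌈log₂⌉-mono-≤; ⌈log₂⌈n/2⌉⌉≡⌈log₂n⌉∸1)
open import Data.Nat.Properties hiding (_≟_)
open import Data.Nat.Tactic.RingSolver using (solve-∀)
open import Data.Product using (∃-syntax)
open import Data.Sum using (_⊎_; inj₁; inj₂; [_,_])
open import Data.Unit using (tt) renaming (⊤ to Unit)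
import Data.Vec as Vec
open import Data.Vec.Properties using (lookup-replicate; lookup∘update′; lookup∘tabulate)
open import Function using (_∘_; id)
open import Function.Bundles using (mk↔ₛ′)
open import Relation.Binary.PropositionalEquality
  using (refl; sym; trans; cong; cong₂; subst; _≢_; module ≡-Reasoning)
open import Relation.Nullary using (¬_; yes; no)
open import Relation.Nullary.Decidable using (⌊_⌋; dec-true; isYes≗does)

-- Placing each element among the parts by binary search costs about `n log k` queries. An answer
-- can carry about `log n` bits, and weighing exploits this by serving many elements at once: labels
-- of `8 * j` bits for `m` elements take `8 * j` rounds of about `2 * m / j` queries, so O(1)
-- queries per element. The obstacle is that a full group of order `j` has about `j * 2 ^ j` coins,
-- while the last group of every round may be almost empty. Blocks must be large against `2 ^ j`
-- before order `j` pays off, whence the doubling of `j` from level to level. An element that stays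
-- a representative costs only O(1 / j) at a level, and these costs form a geometric series. One
-- contraction does not suffice, because it hides the basis elements that it contracts. These are
-- classified in a second matroid: inside `B ∪ Y` every part is a circuit of `r i + 1` elements, and
-- the dual of a circuit has rank 1.

private
  variable
    n k : ℕ
    A A′ : Set

-- Weights of lists under Boolean predicates

+-swap : ∀ a b c → a + (b + c) ≡ b + (a + c)
+-swap = solve-∀

b2n : Bool → ℕ
b2n true  = 1
b2n false = 0

wt : (A → Bool) → List A → ℕ
wt v []      = 0
wt v (x ∷ l) = b2n (v x) + wt v l

b2n≤1 : ∀ b → b2n b ≤ 1
b2n≤1 true  = ≤-refl
b2n≤1 false = z≤n

wt-++ : (v : A → Bool) (l m : List A) → wt v (l ++ m) ≡ wt v l + wt v m
wt-++ v []      m = refl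
wt-++ v (x ∷ l) m rewrite wt-++ v l m = sym (+-assoc (b2n (v x)) _ _)

wt-map : (v : A′ → Bool) (g : A → A′) (l : List A) → wt v (map g l) ≡ wt (v ∘ g) l
wt-map v g []      = refl
wt-map v g (x ∷ l) = cong (b2n (v (g x)) +_) (wt-map v g l)

wt-cong : {v w : A → Bool} → (∀ x → v x ≡ w x) → ∀ l → wt v l ≡ wt w l
wt-cong e []      = refl
wt-cong e (x ∷ l) = cong₂ _+_ (cong b2n (e x)) (wt-cong e l)

wt-false : (l : List A) → wt (λ _ → false) l ≡ 0
wt-false []      = refl
wt-false (x ∷ l) = wt-false l

wt-true : (l : List A) → wt (λ _ → true) l ≡ length l
wt-true []      = refl
wt-true (x ∷ l) = cong suc (wt-true l)

wt≤length : (v : A → Bool) (l : List A) → wt v l ≤ length l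
wt≤length v []      = z≤n
wt≤length v (x ∷ l) = +-mono-≤ (b2n≤1 (v x)) (wt≤length v l)

wt-split : (m v : A → Bool) (l : List A) →
  wt (λ x → m x ∧ v x) l + wt (λ x → not (m x) ∧ v x) l ≡ wt v l
wt-split m v []      = refl
wt-split m v (x ∷ l) with m x
... | true  = trans (+-assoc (b2n (v x)) _ _) (cong (b2n (v x) +_) (wt-split m v l))
... | false = trans (+-swap (wt (λ y → m y ∧ v y) l) (b2n (v x)) _) (cong (b2n (v x) +_) (wt-split m v l))

wt-filter : (m v : A → Bool) (l : List A) → wt v (filterᵇ m l) ≡ wt (λ x → m x ∧ v x) l
wt-filter m v []      = refl
wt-filter m v (x ∷ l) with m x
... | true  = cong (b2n (v x) +_) (wt-filter m v l)
... | false = wt-filter m v l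

wt-∈ : (v : A → Bool) {x : A} {l : List A} → x ∈ l → v x ≡ true → 1 ≤ wt v l
wt-∈ v (here refl) e rewrite e = s≤s z≤n
wt-∈ v (there {x = y} i) e = ≤-trans (wt-∈ v i e) (m≤n+m _ (b2n (v y)))

wt-find : (v : A → Bool) (l : List A) → 1 ≤ wt v l → ∃[ x ] (x ∈ l × v x ≡ true)
wt-find v (x ∷ l) h with v x in e
... | true  = x , here refl , e
... | false with wt-find v l h
... | y , i , e′ = y , there i , e′

wt-none : (v : A → Bool) (l : List A) → (∀ {x} → x ∈ l → v x ≡ false) → wt v l ≡ 0
wt-none v []      h = refl
wt-none v (x ∷ l) h rewrite h (here refl) = wt-none v l (h ∘ there)

-- Inclusion of multisets.  Quantifying over all predicates makes the bounds on
-- multiplicities, class counts and lengths instances of one hypothesis.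
infix 4 _⊑_

record _⊑_ {A : Set} (S L : List A) : Set where
  constructor sub
  field
    wt-≤ : ∀ v → wt v S ≤ wt v L

open _⊑_ public

⊑-length : {S L : List A} → S ⊑ L → length S ≤ length L
⊑-length {S = S} {L} (sub h) = begin
  length S              ≡⟨ wt-true S ⟨
  wt (λ _ → true) S     ≤⟨ h (λ _ → true) ⟩
  wt (λ _ → true) L     ≡⟨ wt-true L ⟩
  length L              ∎
  where open ≤-Reasoning

⊑-refl : {S : List A} → S ⊑ S
⊑-refl = sub (λ _ → ≤-refl)

⊑-trans : {S T U : List A} → S ⊑ T → T ⊑ U → S ⊑ U
⊑-trans (sub g) (sub h) = sub (λ v → ≤-trans (g v) (h v))

⊑-++ˡ : (S T : List A) → S ⊑ S ++ T
⊑-++ˡ S T = sub (λ v → ≤-trans (m≤m+n _ _) (≤-reflexive (sym (wt-++ v S T))))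

⊑-++ʳ : (S T : List A) → T ⊑ S ++ T
⊑-++ʳ S T = sub (λ v → ≤-trans (m≤n+m _ _) (≤-reflexive (sym (wt-++ v S T))))

⊑-++ : {S S′ T T′ : List A} → S ⊑ S′ → T ⊑ T′ → S ++ T ⊑ S′ ++ T′
⊑-++ {S = S} {S′} {T} {T′} (sub g) (sub h) = sub (λ v → ≤-trans (≤-reflexive (wt-++ v S T))
  (≤-trans (+-mono-≤ (g v) (h v)) (≤-reflexive (sym (wt-++ v S′ T′)))))

⊑-∈ : {S L : List A} {x : A} → S ⊑ L → x ∈ S → (v : A → Bool) → v x ≡ true → ∃[ y ] (y ∈ L × v y ≡ true)
⊑-∈ {L = L} (sub h) i v e = wt-find v L (≤-trans (wt-∈ v i e) (h v))

filter-⊑ : (m : A → Bool) (l : List A) → filterᵇ m l ⊑ l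
filter-⊑ m l = sub λ v → subst (_≤ wt v l) (sym (wt-filter m v l))
  (≤-trans (m≤m+n _ _) (≤-reflexive (wt-split m v l)))

-- Class counts and independence

cnt : (Fin n → Fin k) → Fin k → List (Fin n) → ℕ
cnt p i = wt (λ x → ⌊ p x ≟ i ⌋)

-- Independence for capacity one on every class, the notion that matters after the reduction; it is
-- not independence in the given matroid.
Indep : (Fin n → Fin k) → List (Fin n) → Set
Indep p L = ∀ i → cnt p i L ≤ 1

Uniq : List (Fin n) → Set
Uniq = Indep id

⌊≟⌋-refl : (i : Fin k) → ⌊ i ≟ i ⌋ ≡ true
⌊≟⌋-refl i = trans (isYes≗does (i ≟ i)) (dec-true (i ≟ i) refl)

⌊≟⌋-≡ : {i j : Fin k} → ⌊ i ≟ j ⌋ ≡ true → i ≡ j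
⌊≟⌋-≡ {i = i} {j} h with i ≟ j
... | yes e = e

cnt-∈ : (p : Fin n → Fin k) {x : Fin n} {L : List (Fin n)} → x ∈ L → 1 ≤ cnt p (p x) L
cnt-∈ p {x} i = wt-∈ _ i (⌊≟⌋-refl (p x))

⊑⇒⊆ : {S L : List (Fin n)} {x : Fin n} → S ⊑ L → x ∈ S → x ∈ L
⊑⇒⊆ {L = L} {x} h i with ⊑-∈ h i (λ y → ⌊ y ≟ x ⌋) (⌊≟⌋-refl x)
... | y , i′ , e = subst (_∈ L) (⌊≟⌋-≡ e) i′

-- Sums over classes

∑ : (Fin k → ℕ) → ℕ
∑ f = Vec.sum (Vec.tabulate f)

∑-cong : {f g : Fin k → ℕ} → (∀ i → f i ≡ g i) → ∑ f ≡ ∑ g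
∑-cong {zero}  e = refl
∑-cong {suc k} e = cong₂ _+_ (e zero) (∑-cong (e ∘ suc))

∑-+ : (f g : Fin k → ℕ) → ∑ (λ i → f i + g i) ≡ ∑ f + ∑ g
∑-+ {zero}  f g = refl
∑-+ {suc k} f g rewrite ∑-+ (f ∘ suc) (g ∘ suc) = lemma (f zero) (g zero) _ _
  where
  lemma : ∀ a b c d → a + b + (c + d) ≡ a + c + (b + d)
  lemma = solve-∀

∑-mono : {f g : Fin k → ℕ} → (∀ i → f i ≤ g i) → ∑ f ≤ ∑ g
∑-mono {zero}  e = z≤n
∑-mono {suc k} e = +-mono-≤ (e zero) (∑-mono (e ∘ suc))

∑-0 : ∑ {k} (λ _ → 0) ≡ 0
∑-0 {zero}  = refl
∑-0 {suc k} = ∑-0 {k}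

∑-1 : ∑ {k} (λ _ → 1) ≡ k
∑-1 {zero}  = refl
∑-1 {suc k} = cong suc (∑-1 {k})

-- No term can have slack when the totals agree. This is how one rank value equal to the cardinality
-- shows that no part overflows.
∑-≤-≡ : {f g : Fin k → ℕ} → (∀ i → f i ≤ g i) → ∑ f ≡ ∑ g → ∀ i → f i ≡ g i
∑-≤-≡ {suc k} {f} {g} h e zero = ≤-antisym (h zero)
  (+-cancelʳ-≤ (∑ (g ∘ suc)) _ _ (≤-trans (≤-reflexive (sym e)) (+-monoʳ-≤ (f zero) (∑-mono (h ∘ suc)))))
∑-≤-≡ {suc k} {f} {g} h e (suc i) = ∑-≤-≡ (h ∘ suc) (≤-antisym (∑-mono (h ∘ suc))
  (+-cancelˡ-≤ (g zero) _ _ (≤-trans (≤-reflexive (sym e)) (+-monoˡ-≤ _ (h zero))))) i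

∑-δ : (c : Fin k) (g : Fin k → ℕ) → ∑ (λ i → b2n ⌊ c ≟ i ⌋ * g i) ≡ g c
∑-δ {suc k} zero g = trans (cong (g zero + 0 +_) (∑-0 {k})) (trans (+-identityʳ _) (+-identityʳ _))
∑-δ {suc k} (suc c) g = trans (∑-cong (λ i → cong (λ b → b2n b * g (suc i)) (lemma i))) (∑-δ c (g ∘ suc))
  where
  lemma : ∀ i → ⌊ suc c ≟ suc i ⌋ ≡ ⌊ c ≟ i ⌋
  lemma i with c ≟ i
  ... | yes _ = refl
  ... | no _  = refl

∑-cnt : (p : Fin n → Fin k) (L : List (Fin n)) → ∑ (λ i → cnt p i L) ≡ length L
∑-cnt {k = k} p [] = ∑-0 {k}
∑-cnt p (x ∷ L) = trans (∑-+ (λ i → b2n ⌊ p x ≟ i ⌋) _) (cong₂ _+_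
  (trans (∑-cong (λ i → sym (*-identityʳ (b2n ⌊ p x ≟ i ⌋)))) (∑-δ (p x) (λ _ → 1))) (∑-cnt p L))

hit : (Fin n → Fin k) → List (Fin n) → Fin n → Bool
hit p Q x = 0 <ᵇ cnt p (p x) Q

b2n-0<ᵇ : ∀ {m} → m ≤ 1 → b2n (0 <ᵇ m) ≡ m
b2n-0<ᵇ z≤n       = refl
b2n-0<ᵇ (s≤s z≤n) = refl

-- As `Q` meets every class at most once, `cnt p i Q` is the indicator of the classes met by `Q`,
-- and the sum regroups by the elements of `T`. For independent `T` the product on the left is the
-- rank that a part of capacity one loses when both lists meet it.
∑-hit : (p : Fin n → Fin k) (T Q : List (Fin n)) → Indep p Q →
  ∑ (λ i → cnt p i T * cnt p i Q) ≡ wt (hit p Q) T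
∑-hit {k = k} p [] Q h = ∑-0 {k}
∑-hit p (x ∷ T) Q h =
  trans (∑-cong (λ i → *-distribʳ-+ (cnt p i Q) (b2n ⌊ p x ≟ i ⌋) (cnt p i T)))
  (trans (∑-+ (λ i → b2n ⌊ p x ≟ i ⌋ * cnt p i Q) _)
  (cong₂ _+_ (trans (∑-δ (p x) (λ i → cnt p i Q)) (sym (b2n-0<ᵇ (h (p x))))) (∑-hit p T Q h)))

-- Lists as query sets

⟦_⟧ : List (Fin n) → Subset n
⟦ [] ⟧    = Vec.replicate _ false
⟦ x ∷ L ⟧ = ⟦ L ⟧ Vec.[ x ]≔ true

private
  insert-∩ : (S P : Subset n) (x : Fin n) → Vec.lookup S x ≡ false →
    ∣ (S Vec.[ x ]≔ true) ∩ P ∣ ≡ b2n (Vec.lookup P x) + ∣ S ∩ P ∣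
  insert-∩ (false Vec.∷ S) (true  Vec.∷ P) zero e = refl
  insert-∩ (false Vec.∷ S) (false Vec.∷ P) zero e = refl
  insert-∩ (s Vec.∷ S) (t Vec.∷ P) (suc x) e with s ∧ t
  ... | false = insert-∩ S P x e
  ... | true  = trans (cong suc (insert-∩ S P x e)) (sym (+-suc _ _))

⟦⟧-∉ : (L : List (Fin n)) (x : Fin n) → cnt id x L ≡ 0 → Vec.lookup ⟦ L ⟧ x ≡ false
⟦⟧-∉ []      x e = lookup-replicate x false
⟦⟧-∉ (y ∷ L) x e with y ≟ x
... | no ne = trans (lookup∘update′ (λ q → ne (sym q)) ⟦ L ⟧ true) (⟦⟧-∉ L x e)

∅-∩ : (P : Subset n) → ∣ Vec.replicate _ false ∩ P ∣ ≡ 0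
∅-∩ Vec.[]      = refl
∅-∩ (x Vec.∷ P) = ∅-∩ P

Uniq-tail : (x : Fin n) (L : List (Fin n)) → Uniq (x ∷ L) → Uniq L
Uniq-tail x L u i = ≤-trans (m≤n+m _ (b2n ⌊ x ≟ i ⌋)) (u i)

Uniq-head : (x : Fin n) (L : List (Fin n)) → Uniq (x ∷ L) → cnt id x L ≡ 0
Uniq-head x L u = n≤0⇒n≡0 (+-cancelˡ-≤ 1 _ _ (subst (λ b → b2n b + cnt id x L ≤ 1) (⌊≟⌋-refl x) (u x)))

-- A subset forgets multiplicities; without repetitions in `L` every insertion meets an unset
-- position and so raises the count of its class.
⟦⟧-part : (p : Fin n → Fin k) (L : List (Fin n)) → Uniq L → ∀ i → ∣ ⟦ L ⟧ ∩ Part p i ∣ ≡ cnt p i L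
⟦⟧-part p []      u i = ∅-∩ (Part p i)
⟦⟧-part p (x ∷ L) u i = trans (insert-∩ ⟦ L ⟧ (Part p i) x (⟦⟧-∉ L x (Uniq-head x L u)))
  (cong₂ _+_ (cong b2n (lookup∘tabulate _ x)) (⟦⟧-part p L (Uniq-tail x L u) i))

rank-⟦⟧ : (p : Fin n → Fin k) (r : Fin k → ℕ) (L : List (Fin n)) → Uniq L →
  rank p r ⟦ L ⟧ ≡ ∑ (λ i → cnt p i L ⊓ r i)
rank-⟦⟧ p r L u = ∑-cong (λ i → cong (_⊓ r i) (⟦⟧-part p L u i))

-- Sequencing of algorithms, with result and cost together

infixl 1 _>>=_

_>>=_ : Alg n A → (A → Alg n A′) → Alg n A′
done a  >>= g = g a
ask S c >>= g = ask S (λ a → c a >>= g)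

Runs : (Subset n → ℕ) → Alg n A → A → ℕ → Set
Runs f m a c = run m f ≡ (a , c)

runs-ask : {f : Subset n → ℕ} {S : Subset n} {g : ℕ → Alg n A} {a : A} {c : ℕ} →
  Runs f (g (f S)) a c → Runs f (ask S g) a (suc c)
runs-ask {f = f} {S} {g} h with run (g (f S)) f
runs-ask refl | _ = refl

runs-bind : {f : Subset n → ℕ} (m : Alg n A) {g : A → Alg n A′} {a : A} {b : A′} {c d : ℕ} →
  Runs f m a c → Runs f (g a) b d → Runs f (m >>= g) b (c + d)
runs-bind (done x) refl h = h
runs-bind {f = f} (ask S t) h h′ with run (t (f S)) f in e
runs-bind {f = f} (ask S t) refl h′ | a , c = runs-ask {f = f} {S} {λ b → t b >>= _} (runs-bind (t (f S)) e h′)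

-- Coin weighing

odd : ℕ → Bool
odd zero    = false
odd (suc m) = not (odd m)

-- The Cantor–Mills scheme.  Given a scheme with queries q, take two copies a, b of
-- its coins and one extra coin x_q per query, and weigh  a_q + b_q + x_q,
-- a_q + (b without b_q)  and the total of b.  The sum of the three weights is
-- x_q + 2 (a_q + total), so its parity gives x_q and its half gives a_q.
Qry Coin : ℕ → Set
Qry zero     = Unit
Qry (suc j)  = Qry j ⊎ Qry j ⊎ Unit
Coin zero    = Unit
Coin (suc j) = Coin j ⊎ Coin j ⊎ Qry j

qrys : ∀ j → List (Qry j)
qrys zero    = tt ∷ []
qrys (suc j) = map inj₁ (qrys j) ++ map (inj₂ ∘ inj₁) (qrys j) ++ inj₂ (inj₂ tt) ∷ []

coins : ∀ j → List (Coin j)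
coins zero    = tt ∷ []
coins (suc j) = map inj₁ (coins j) ++ map (inj₂ ∘ inj₁) (coins j) ++ map (inj₂ ∘ inj₂) (qrys j)

#q #c : ℕ → ℕ
#q j = length (qrys j)
#c j = length (coins j)

eqQ : ∀ j → Qry j → Qry j → Bool
eqQ zero    _               _               = true
eqQ (suc j) (inj₁ x)        (inj₁ y)        = eqQ j x y
eqQ (suc j) (inj₂ (inj₁ x)) (inj₂ (inj₁ y)) = eqQ j x y
eqQ (suc j) (inj₂ (inj₂ _)) (inj₂ (inj₂ _)) = true
eqQ (suc j) _               _               = false

mask : ∀ j → Qry j → Coin j → Bool
mask zero    _               _               = true
mask (suc j) (inj₁ q)        (inj₁ c)        = mask j q c
mask (suc j) (inj₁ q)        (inj₂ (inj₁ c)) = mask j q c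
mask (suc j) (inj₁ q)        (inj₂ (inj₂ c)) = eqQ j q c
mask (suc j) (inj₂ (inj₁ q)) (inj₁ c)        = mask j q c
mask (suc j) (inj₂ (inj₁ q)) (inj₂ (inj₁ c)) = not (mask j q c)
mask (suc j) (inj₂ (inj₁ q)) (inj₂ (inj₂ c)) = false
mask (suc j) (inj₂ (inj₂ _)) (inj₁ c)        = false
mask (suc j) (inj₂ (inj₂ _)) (inj₂ (inj₁ c)) = true
mask (suc j) (inj₂ (inj₂ _)) (inj₂ (inj₂ c)) = false

decode : ∀ j → (Qry j → ℕ) → Coin j → Bool
decode zero    ans c = odd (ans c)
decode (suc j) ans   = λ where
    (inj₁ c)        → decode j left c
    (inj₂ (inj₁ c)) → decode j right c
    (inj₂ (inj₂ q)) → odd (both q)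
  where
  total : ℕ
  total = ans (inj₂ (inj₂ tt))
  both left right : Qry j → ℕ
  both q  = ans (inj₁ q) + ans (inj₂ (inj₁ q)) + total
  left q  = ⌊ both q /2⌋ ∸ total
  right q = ans (inj₁ q) ∸ left q ∸ b2n (odd (both q))

dot : ∀ j → (Coin j → Bool) → (Coin j → Bool) → ℕ
dot j m v = wt (λ c → m c ∧ v c) (coins j)

private
  wt-3 : {X Y Z : Set} (v : X ⊎ Y ⊎ Z → Bool) (xs : List X) (ys : List Y) (zs : List Z) →
    wt v (map inj₁ xs ++ map (inj₂ ∘ inj₁) ys ++ map (inj₂ ∘ inj₂) zs)
      ≡ wt (v ∘ inj₁) xs + (wt (v ∘ inj₂ ∘ inj₁) ys + wt (v ∘ inj₂ ∘ inj₂) zs)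
  wt-3 v xs ys zs = trans (wt-++ v (map inj₁ xs) _) (cong₂ _+_ (wt-map v inj₁ xs)
    (trans (wt-++ v (map (inj₂ ∘ inj₁) ys) _) (cong₂ _+_ (wt-map v (inj₂ ∘ inj₁) ys) (wt-map v (inj₂ ∘ inj₂) zs))))

  half-odd : ∀ b m → (odd (b2n b + (m + m)) ≡ b) × (⌊ b2n b + (m + m) /2⌋ ≡ m)
  half-odd true zero  = refl , refl
  half-odd false zero = refl , refl
  half-odd b (suc m) with half-odd b m
  ... | e₁ , e₂ = trans (cong odd eq) (trans (not-involutive _) e₁) , trans (cong ⌊_/2⌋ eq) (cong suc e₂)
    where
    eq : b2n b + (suc m + suc m) ≡ suc (suc (b2n b + (m + m)))
    eq = lemma (b2n b) m
      where
      lemma : ∀ a m → a + (suc m + suc m) ≡ suc (suc (a + (m + m)))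
      lemma = solve-∀

-- `qrys j` contains every query exactly once, so each weighing of the first kind involves a single
-- extra coin.
wt-eqQ : ∀ j (q : Qry j) (v : Qry j → Bool) → wt (λ q′ → eqQ j q q′ ∧ v q′) (qrys j) ≡ b2n (v q)
wt-eqQ zero    q v = +-identityʳ _
wt-eqQ (suc j) (inj₁ q) v = trans (wt-3 _ (qrys j) (qrys j) (tt ∷ []))
  (trans (cong₂ _+_ (wt-eqQ j q (v ∘ inj₁)) (cong (_+ 0) (wt-false (qrys j)))) (+-identityʳ _))
wt-eqQ (suc j) (inj₂ (inj₁ q)) v = trans (wt-3 _ (qrys j) (qrys j) (tt ∷ []))
  (cong₂ _+_ (wt-false (qrys j)) (trans (+-identityʳ _) (wt-eqQ j q (v ∘ inj₂ ∘ inj₁))))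
wt-eqQ (suc j) (inj₂ (inj₂ tt)) v = trans (wt-3 _ (qrys j) (qrys j) (tt ∷ []))
  (cong₂ _+_ (wt-false (qrys j)) (trans (cong (_+ wt (v ∘ inj₂ ∘ inj₂) (tt ∷ [])) (wt-false (qrys j))) (+-identityʳ _)))

decode-correct : ∀ j (v : Coin j → Bool) (ans : Qry j → ℕ) → (∀ q → ans q ≡ dot j (mask j q) v) →
  ∀ c → decode j ans c ≡ v c
decode-correct zero v ans h tt = trans (cong odd (h tt)) (odd-b2n (v tt))
  where
  odd-b2n : ∀ b → odd (b2n b + 0) ≡ b
  odd-b2n true  = refl
  odd-b2n false = refl
decode-correct (suc j) v ans h = λ where
    (inj₁ c)        → decode-correct j (v ∘ inj₁) _ left≡ c
    (inj₂ (inj₁ c)) → decode-correct j (v ∘ inj₂ ∘ inj₁) _ right≡ c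
    (inj₂ (inj₂ q)) → odd≡ q
  where
  a b : Qry j → ℕ
  a q = dot j (mask j q) (v ∘ inj₁)
  b q = dot j (mask j q) (v ∘ inj₂ ∘ inj₁)
  b̄ : Qry j → ℕ
  b̄ q = dot j (not ∘ mask j q) (v ∘ inj₂ ∘ inj₁)
  x : Qry j → Bool
  x = v ∘ inj₂ ∘ inj₂
  t : ℕ
  t = wt (v ∘ inj₂ ∘ inj₁) (coins j)
  b+b̄ : ∀ q → b q + b̄ q ≡ t
  b+b̄ q = wt-split (mask j q) (v ∘ inj₂ ∘ inj₁) (coins j)
  split : ∀ q → dot (suc j) (mask (suc j) q) v ≡ _
  split q = wt-3 (λ c → mask (suc j) q c ∧ v c) (coins j) (coins j) (qrys j)
  plus : ∀ q → ans (inj₁ q) ≡ a q + (b q + b2n (x q))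
  plus q = trans (h (inj₁ q)) (trans (split (inj₁ q)) (cong (λ z → a q + (b q + z)) (wt-eqQ j q x)))
  minus : ∀ q → ans (inj₂ (inj₁ q)) ≡ a q + (b̄ q + 0)
  minus q = trans (h (inj₂ (inj₁ q))) (trans (split (inj₂ (inj₁ q))) (cong (λ z → a q + (b̄ q + z)) (wt-false (qrys j))))
  total : ans (inj₂ (inj₂ tt)) ≡ t
  total = trans (h (inj₂ (inj₂ tt))) (trans (split (inj₂ (inj₂ tt)))
    (trans (cong₂ (λ y z → y + (t + z)) (wt-false (coins j)) (wt-false (qrys j))) (+-identityʳ t)))
  -- `b q + b̄ q` is again the total `t`, so `a q` and `t` both occur twice and only the extra coin
  -- affects the parity.
  both≡ : ∀ q → ans (inj₁ q) + ans (inj₂ (inj₁ q)) + ans (inj₂ (inj₂ tt)) ≡ b2n (x q) + ((a q + t) + (a q + t))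
  both≡ q rewrite plus q | minus q | total | sym (b+b̄ q) = lemma (a q) (b q) (b̄ q) (b2n (x q))
    where
    lemma : ∀ a b c x → (a + (b + x)) + (a + (c + 0)) + (b + c) ≡ x + ((a + (b + c)) + (a + (b + c)))
    lemma = solve-∀
  odd≡ : ∀ q → odd (ans (inj₁ q) + ans (inj₂ (inj₁ q)) + ans (inj₂ (inj₂ tt))) ≡ x q
  odd≡ q = trans (cong odd (both≡ q)) (proj₁ (half-odd (x q) (a q + t)))
  left≡ : ∀ q → ⌊ ans (inj₁ q) + ans (inj₂ (inj₁ q)) + ans (inj₂ (inj₂ tt)) /2⌋ ∸ ans (inj₂ (inj₂ tt)) ≡ a q
  left≡ q = trans (cong₂ _∸_ (trans (cong ⌊_/2⌋ (both≡ q)) (proj₂ (half-odd (x q) (a q + t)))) total) (m+n∸n≡m (a q) t)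
  right≡ : ∀ q → ans (inj₁ q) ∸ (⌊ ans (inj₁ q) + ans (inj₂ (inj₁ q)) + ans (inj₂ (inj₂ tt)) /2⌋ ∸ ans (inj₂ (inj₂ tt)))
             ∸ b2n (odd (ans (inj₁ q) + ans (inj₂ (inj₁ q)) + ans (inj₂ (inj₂ tt)))) ≡ b q
  right≡ q = trans (cong₂ _∸_ (cong₂ _∸_ (plus q) (left≡ q)) (cong b2n (odd≡ q)))
    (trans (cong (_∸ b2n (x q)) (m+n∸m≡n (a q) _)) (m+n∸n≡m (b q) (b2n (x q))))

#q-suc : ∀ j → #q (suc j) ≡ suc (2 * #q j)
#q-suc j = trans (length-++ (map inj₁ (qrys j))) (trans (cong₂ _+_ (length-map inj₁ (qrys j))
  (trans (length-++ (map (inj₂ ∘ inj₁) (qrys j))) (cong (_+ 1) (length-map (inj₂ ∘ inj₁) (qrys j)))))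
  (lemma (#q j)))
  where
  lemma : ∀ q → q + (q + 1) ≡ suc (2 * q)
  lemma = solve-∀

#c-suc : ∀ j → #c (suc j) ≡ #c j + (#c j + #q j)
#c-suc j = trans (length-++ (map inj₁ (coins j))) (cong₂ _+_ (length-map inj₁ (coins j))
  (trans (length-++ (map (inj₂ ∘ inj₁) (coins j))) (cong₂ _+_ (length-map _ (coins j)) (length-map _ (qrys j)))))

#q≡ : ∀ j → suc (#q j) ≡ 2 * 2 ^ j
#q≡ zero    = refl
#q≡ (suc j) = trans (cong suc (#q-suc j)) (trans (lemma (#q j)) (cong (2 *_) (#q≡ j)))
  where
  lemma : ∀ q → suc (suc (2 * q)) ≡ 2 * suc q
  lemma = solve-∀

-- In particular j * #q j ≤ 2 * #c j: a query pays for about j / 2 coins.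
#q-#c : ∀ j → j * #q j + j + 2 ≡ 2 * #c j
#q-#c zero    = refl
#q-#c (suc j) rewrite #q-suc j | #c-suc j = begin
  suc j * suc (2 * #q j) + suc j + 2       ≡⟨ lemma₁ j (#q j) ⟩
  2 * (j * #q j + j + 2) + 2 * #q j        ≡⟨ cong (λ z → 2 * z + 2 * #q j) (#q-#c j) ⟩
  2 * (2 * #c j) + 2 * #q j                ≡⟨ lemma₂ (#c j) (#q j) ⟩
  2 * (#c j + (#c j + #q j))               ∎
  where
  open ≡-Reasoning
  lemma₁ : ∀ j q → suc j * suc (2 * q) + suc j + 2 ≡ 2 * (j * q + j + 2) + 2 * q
  lemma₁ = solve-∀
  lemma₂ : ∀ c q → 2 * (2 * c) + 2 * q ≡ 2 * (c + (c + q))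
  lemma₂ = solve-∀

-- Distributing a list over the coins of a scheme

fillQ : ∀ j → List A → Qry j → Maybe A
fillQ zero    L q                = head L
fillQ (suc j) L (inj₁ q)         = fillQ j (take (#q j) L) q
fillQ (suc j) L (inj₂ (inj₁ q))  = fillQ j (take (#q j) (drop (#q j) L)) q
fillQ (suc j) L (inj₂ (inj₂ _))  = head (drop (#q j) (drop (#q j) L))

-- Slots are filled in the order of `coins j`, so that collecting the filled ones gives the list
-- back; slots beyond its end hold `nothing`.
fill : ∀ j → List A → Coin j → Maybe A
fill zero    L c               = head L
fill (suc j) L (inj₁ c)        = fill j (take (#c j) L) c
fill (suc j) L (inj₂ (inj₁ c)) = fill j (take (#c j) (drop (#c j) L)) c
fill (suc j) L (inj₂ (inj₂ q)) = fillQ j (drop (#c j) (drop (#c j) L)) q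

mapMaybe-++ : (f : A → Maybe A′) (xs ys : List A) → mapMaybe f (xs ++ ys) ≡ mapMaybe f xs ++ mapMaybe f ys
mapMaybe-++ f xs ys = trans (cong catMaybes (map-++ f xs ys)) (catMaybes-++ (map f xs) (map f ys))

private
  mapMaybe-3 : {X Y Z : Set} (f : X ⊎ Y ⊎ Z → Maybe A) (xs : List X) (ys : List Y) (zs : List Z) →
    mapMaybe f (map inj₁ xs ++ map (inj₂ ∘ inj₁) ys ++ map (inj₂ ∘ inj₂) zs)
      ≡ mapMaybe (f ∘ inj₁) xs ++ (mapMaybe (f ∘ inj₂ ∘ inj₁) ys ++ mapMaybe (f ∘ inj₂ ∘ inj₂) zs)
  mapMaybe-3 f xs ys zs = trans (mapMaybe-++ f (map inj₁ xs) _) (cong₂ _++_ (cong catMaybes (sym (map-∘ xs)))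
    (trans (mapMaybe-++ f (map (inj₂ ∘ inj₁) ys) _)
      (cong₂ _++_ (cong catMaybes (sym (map-∘ ys))) (cong catMaybes (sym (map-∘ zs))))))

  length-take≤ : ∀ m (L : List A) → length (take m L) ≤ m
  length-take≤ m L = ≤-trans (≤-reflexive (length-take m L)) (m⊓n≤m m _)

  length-drop≤ : ∀ m r (L : List A) → length L ≤ m + r → length (drop m L) ≤ r
  length-drop≤ m r L h = ≤-trans (≤-reflexive (length-drop m L)) (m≤n+o⇒m∸n≤o (length L) m h)

  take-take-drop : ∀ m (L : List A) → take m L ++ (take m (drop m L) ++ drop m (drop m L)) ≡ L
  take-take-drop m L = trans (cong (take m L ++_) (take++drop≡id m (drop m L))) (take++drop≡id m L)

  head-short : (L : List A) → length L ≤ 1 → catMaybes (head L ∷ []) ≡ L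
  head-short []          h = refl
  head-short (x ∷ [])    h = refl
  head-short (x ∷ _ ∷ _) (s≤s ())

fillQ-correct : ∀ j (L : List A) → length L ≤ #q j → mapMaybe (fillQ j L) (qrys j) ≡ L
fillQ-correct zero    L h = head-short L h
fillQ-correct (suc j) L h = trans (mapMaybe-3 (fillQ (suc j) L) (qrys j) (qrys j) (tt ∷ []))
  (trans (cong₂ _++_ (fillQ-correct j _ (length-take≤ (#q j) L))
           (cong₂ _++_ (fillQ-correct j _ (length-take≤ (#q j) (drop (#q j) L)))
             (head-short _ (length-drop≤ (#q j) 1 _ (length-drop≤ (#q j) (#q j + 1) L
               (≤-trans h (≤-reflexive (trans (#q-suc j) (lemma (#q j))))))))))
    (take-take-drop (#q j) L))
  where
  lemma : ∀ q → suc (2 * q) ≡ q + (q + 1)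
  lemma = solve-∀

fill-correct : ∀ j (L : List A) → length L ≤ #c j → mapMaybe (fill j L) (coins j) ≡ L
fill-correct zero    L h = head-short L h
fill-correct (suc j) L h = trans (mapMaybe-3 (fill (suc j) L) (coins j) (coins j) (qrys j))
  (trans (cong₂ _++_ (fill-correct j _ (length-take≤ (#c j) L))
           (cong₂ _++_ (fill-correct j _ (length-take≤ (#c j) (drop (#c j) L)))
             (fillQ-correct j _ (length-drop≤ (#c j) (#q j) _ (length-drop≤ (#c j) (#c j + #q j) L
               (≤-trans h (≤-reflexive (#c-suc j))))))))
    (take-take-drop (#c j) L))

select : ∀ j → List A → Qry j → List A
select j L q = mapMaybe (λ c → if mask j q c then fill j L c else nothing) (coins j)

valueAt : (A → Bool) → Maybe A → Bool
valueAt v = maybe v false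

wt-mapMaybe : (w : A → Bool) (f : A′ → Maybe A) (cs : List A′) → wt w (mapMaybe f cs) ≡ wt (valueAt w ∘ f) cs
wt-mapMaybe w f []       = refl
wt-mapMaybe w f (c ∷ cs) with f c
... | just x  = cong (b2n (w x) +_) (wt-mapMaybe w f cs)
... | nothing = wt-mapMaybe w f cs

-- A weighing of list elements becomes one of abstract coins, the empty slots being coins of value
-- `false`. This makes `decode-correct` available for partially filled schemes.
wt-select : ∀ j (L : List A) (q : Qry j) (w : A → Bool) →
  wt w (select j L q) ≡ dot j (mask j q) (valueAt w ∘ fill j L)
wt-select j L q w = trans (wt-mapMaybe w _ (coins j)) (wt-cong pointwise (coins j))
  where
  pointwise : ∀ c → valueAt w (if mask j q c then fill j L c else nothing) ≡ mask j q c ∧ valueAt w (fill j L c)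
  pointwise c with mask j q c
  ... | true  = refl
  ... | false = refl

select-⊑ : ∀ j (L : List A) (q : Qry j) → length L ≤ #c j → select j L q ⊑ L
select-⊑ j L q h = sub λ w → begin
  wt w (select j L q)                       ≡⟨ wt-select j L q w ⟩
  dot j (mask j q) (valueAt w ∘ fill j L)   ≤⟨ m≤m+n _ _ ⟩
  _                                         ≡⟨ wt-split (mask j q) _ (coins j) ⟩
  wt (valueAt w ∘ fill j L) (coins j)       ≡⟨ wt-mapMaybe w (fill j L) (coins j) ⟨
  wt w (mapMaybe (fill j L) (coins j))      ≡⟨ cong (wt w) (fill-correct j L h) ⟩
  wt w L                                    ∎
  where open ≤-Reasoning

readOff : ∀ j → List A → (Qry j → ℕ) → List Bool
readOff j L ans = mapMaybe (λ c → Maybe.map (λ _ → decode j ans c) (fill j L c)) (coins j)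

readOff-correct : ∀ j (L : List A) (v : A → Bool) (ans : Qry j → ℕ) → length L ≤ #c j →
  (∀ q → ans q ≡ wt v (select j L q)) → readOff j L ans ≡ map v L
readOff-correct j L v ans h e = begin
  readOff j L ans                                        ≡⟨ mapMaybe-cong pointwise (coins j) ⟩
  mapMaybe (Maybe.map v ∘ fill j L) (coins j)            ≡⟨ cong catMaybes (map-∘ (coins j)) ⟩
  catMaybes (map (Maybe.map v) (map (fill j L) (coins j))) ≡⟨ map-catMaybes v (map (fill j L) (coins j)) ⟨
  map v (mapMaybe (fill j L) (coins j))                  ≡⟨ cong (map v) (fill-correct j L h) ⟩
  map v L                                                ∎
  where
  open ≡-Reasoning
  decoded : ∀ c → decode j ans c ≡ valueAt v (fill j L c)
  decoded = decode-correct j _ ans (λ q → trans (e q) (wt-select j L q v))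
  pointwise : ∀ c → Maybe.map (λ _ → decode j ans c) (fill j L c) ≡ Maybe.map v (fill j L c)
  pointwise c with fill j L c | decoded c
  ... | just x  | eq = cong just eq
  ... | nothing | eq = refl

-- Cutting a list into chunks

chunksFuel : ℕ → ℕ → List A → List (List A)
chunksFuel zero    N L = L ∷ []
chunksFuel (suc f) N L with length L ≤? N
... | yes _ = L ∷ []
... | no _  = take N L ∷ chunksFuel f N (drop N L)

chunks : ℕ → List A → List (List A)
chunks N L = chunksFuel (length L) N L

private
  chunksFuel-concat : ∀ f N (L : List A) → concat (chunksFuel f N L) ≡ L
  chunksFuel-concat zero    N L = ++-identityʳ L
  chunksFuel-concat (suc f) N L with length L ≤? N
  ... | yes _ = ++-identityʳ L
  ... | no _  = trans (cong (take N L ++_) (chunksFuel-concat f N (drop N L))) (take++drop≡id N L)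

  chunksFuel-short : ∀ f N (L : List A) → 1 ≤ N → length L ≤ f → All (λ c → length c ≤ N) (chunksFuel f N L)
  chunksFuel-short zero    N L N≥1 h = ≤-trans h z≤n ∷ []
  chunksFuel-short (suc f) N L N≥1 h with length L ≤? N
  ... | yes p = p ∷ []
  ... | no _  = length-take≤ N L ∷ chunksFuel-short f N (drop N L) N≥1
                  (length-drop≤ N f L (≤-trans h (+-monoˡ-≤ f N≥1)))

  chunksFuel-count : ∀ f N (L : List A) → ∃[ g ] (length (chunksFuel f N L) ≡ suc g × g * N ≤ length L)
  chunksFuel-count zero    N L = 0 , refl , z≤n
  chunksFuel-count (suc f) N L with length L ≤? N
  ... | yes _ = 0 , refl , z≤n
  ... | no N<L with chunksFuel-count f N (drop N L)
  ... | g , e , b = suc g , cong suc e , ≤-trans (+-monoʳ-≤ N (≤-trans b (≤-reflexive (length-drop N L))))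
                      (≤-reflexive (m+[n∸m]≡n (<⇒≤ (≰⇒> N<L))))

chunks-concat : ∀ N (L : List A) → concat (chunks N L) ≡ L
chunks-concat N L = chunksFuel-concat (length L) N L

chunks-short : ∀ N (L : List A) → 1 ≤ N → All (λ c → length c ≤ N) (chunks N L)
chunks-short N L N≥1 = chunksFuel-short (length L) N L N≥1 ≤-refl

-- `g` counts the chunks before the last, which are all full. The last one may be partial or even
-- empty, so it is the only one that its elements may fail to pay for.
chunks-count : ∀ N (L : List A) → ∃[ g ] (length (chunks N L) ≡ suc g × g * N ≤ length L)
chunks-count N L = chunksFuel-count (length L) N L

-- Weighing a whole list by queries

askAll : ∀ j → (Qry j → Alg n ℕ) → Alg n (Qry j → ℕ)
askAll zero    g = g tt >>= λ a → done (λ _ → a)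
askAll (suc j) g =
  askAll j (g ∘ inj₁) >>= λ a →
  askAll j (g ∘ inj₂ ∘ inj₁) >>= λ b →
  g (inj₂ (inj₂ tt)) >>= λ t →
  done [ a , [ b , (λ _ → t) ] ]

askAll-runs : ∀ {f : Subset n → ℕ} j (g : Qry j → Alg n ℕ) (h : Qry j → ℕ) → (∀ q → Runs f (g q) (h q) 1) →
  ∃[ ans ] (Runs f (askAll j g) ans (#q j) × (∀ q → ans q ≡ h q))
askAll-runs zero    g h r = _ , runs-bind (g tt) (r tt) refl , λ _ → refl
askAll-runs {f = f} (suc j) g h r
  with askAll-runs j (g ∘ inj₁) (h ∘ inj₁) (r ∘ inj₁) | askAll-runs j (g ∘ inj₂ ∘ inj₁) (h ∘ inj₂ ∘ inj₁) (r ∘ inj₂ ∘ inj₁)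
... | a , ra , ea | b , rb , eb =
  _ , subst (Runs f (askAll (suc j) g) _) (trans (lemma (#q j)) (sym (#q-suc j)))
        (runs-bind (askAll j (g ∘ inj₁)) ra (runs-bind (askAll j (g ∘ inj₂ ∘ inj₁)) rb
          (runs-bind (g (inj₂ (inj₂ tt))) (r (inj₂ (inj₂ tt))) refl)))
    , λ where
        (inj₁ q)        → ea q
        (inj₂ (inj₁ q)) → eb q
        (inj₂ (inj₂ _)) → refl
  where
  lemma : ∀ q → q + (q + (1 + 0)) ≡ suc (2 * q)
  lemma = solve-∀

weighGroup : ∀ j → (List A → Alg n ℕ) → List A → Alg n (List Bool)
weighGroup j W L = askAll j (W ∘ select j L) >>= λ ans → done (readOff j L ans)

weighGroups : ∀ j → (List A → Alg n ℕ) → List (List A) → Alg n (List Bool)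
weighGroups j W []       = done []
weighGroups j W (c ∷ cs) = weighGroup j W c >>= λ b → weighGroups j W cs >>= λ bs → done (b ++ bs)

weighAll : ∀ j → (List A → Alg n ℕ) → List A → Alg n (List Bool)
weighAll j W L = weighGroups j W (chunks (#c j) L)

weighCost : ℕ → List A → ℕ
weighCost j L = length (chunks (#c j) L) * #q j

-- Freed of division, the bound is `#q j` queries plus `2 / j` per element: full groups are paid for
-- by their coins through `#q-#c`, and the additive term is the last group.
weighCost-≤ : ∀ j (L : List A) → j * weighCost j L ≤ j * #q j + 2 * length L
weighCost-≤ j L with chunks-count (#c j) L
... | g , e , b rewrite e = begin
  j * (suc g * #q j)         ≡⟨ lemma j g (#q j) ⟩
  j * #q j + g * (j * #q j)  ≤⟨ +-monoʳ-≤ (j * #q j) (*-monoʳ-≤ g rate) ⟩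
  j * #q j + g * (2 * #c j)  ≡⟨ cong (j * #q j +_) (lemma₂ g (#c j)) ⟩
  j * #q j + 2 * (g * #c j)  ≤⟨ +-monoʳ-≤ (j * #q j) (*-monoʳ-≤ 2 b) ⟩
  j * #q j + 2 * length L    ∎
  where
  open ≤-Reasoning
  lemma : ∀ j g q → j * (suc g * q) ≡ j * q + g * (j * q)
  lemma = solve-∀
  lemma₂ : ∀ g c → g * (2 * c) ≡ 2 * (g * c)
  lemma₂ = solve-∀
  rate : j * #q j ≤ 2 * #c j
  rate = ≤-trans (≤-trans (m≤m+n _ j) (m≤m+n _ 2)) (≤-reflexive (#q-#c j))

1≤#c : ∀ j → 1 ≤ #c j
1≤#c zero    = ≤-refl
1≤#c (suc j) = ≤-trans (1≤#c j) (≤-trans (m≤m+n _ _) (≤-reflexive (sym (#c-suc j))))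

weighGroups-runs : ∀ {f : Subset n → ℕ} j (W : List A → Alg n ℕ) (v : A → Bool) (cs : List (List A)) →
  All (λ c → length c ≤ #c j) cs →
  (∀ T → T ⊑ concat cs → Runs f (W T) (wt v T) 1) →
  Runs f (weighGroups j W cs) (map v (concat cs)) (length cs * #q j)
weighGroups-runs j W v []       _        h = refl
weighGroups-runs {f = f} j W v (c ∷ cs) (s ∷ ss) h
  with askAll-runs {f = f} j (W ∘ select j c) (wt v ∘ select j c)
         (λ q → h _ (⊑-trans (select-⊑ j c q s) (⊑-++ˡ c (concat cs))))
... | ans , ra , ea =
  subst (Runs f (weighGroups j W (c ∷ cs)) _) (cong₂ _+_ (+-identityʳ (#q j)) (+-identityʳ (length cs * #q j)))
   (subst (λ bs → Runs f (weighGroups j W (c ∷ cs)) bs _)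
     (trans (cong (_++ map v (concat cs)) (readOff-correct j c v ans s ea)) (sym (map-++ v c (concat cs))))
     (runs-bind (weighGroup j W c) (runs-bind (askAll j _) ra refl)
       (runs-bind (weighGroups j W cs)
         (weighGroups-runs j W v cs ss (λ T g → h T (⊑-trans g (⊑-++ʳ c (concat cs))))) refl)))

weighAll-runs : ∀ {f : Subset n → ℕ} j (W : List A → Alg n ℕ) (v : A → Bool) (L : List A) →
  (∀ T → T ⊑ L → Runs f (W T) (wt v T) 1) →
  Runs f (weighAll j W L) (map v L) (weighCost j L)
weighAll-runs {f = f} j W v L h = subst (λ K → Runs f (weighAll j W L) (map v K) (weighCost j L))
  (chunks-concat (#c j) L)
  (weighGroups-runs j W v (chunks (#c j) L) (chunks-short (#c j) L (1≤#c j))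
    (λ T g → h T (subst (T ⊑_) (chunks-concat (#c j) L) g)))

-- Merging partitions

map-cong-∈ : (g h : A → A′) (L : List A) → (∀ {x} → x ∈ L → g x ≡ h x) → map g L ≡ map h L
map-cong-∈ g h []      e = refl
map-cong-∈ g h (x ∷ L) e = cong₂ _∷_ (e (here refl)) (map-cong-∈ g h L (e ∘ there))

undouble : ℕ → Bool → ℕ
undouble m b = b2n b + (m + m)

undouble-half : ∀ m → undouble ⌊ m /2⌋ (odd m) ≡ m
undouble-half zero          = refl
undouble-half (suc zero)    = refl
undouble-half (suc (suc m)) = begin
  b2n (not (not (odd m))) + (suc ⌊ m /2⌋ + suc ⌊ m /2⌋)  ≡⟨ cong (λ b → b2n b + (suc ⌊ m /2⌋ + suc ⌊ m /2⌋)) (not-involutive (odd m)) ⟩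
  b2n (odd m) + (suc ⌊ m /2⌋ + suc ⌊ m /2⌋)              ≡⟨ lemma (b2n (odd m)) ⌊ m /2⌋ ⟩
  suc (suc (undouble ⌊ m /2⌋ (odd m)))                   ≡⟨ cong (2 +_) (undouble-half m) ⟩
  suc (suc m)                                            ∎
  where
  open ≡-Reasoning
  lemma : ∀ a m → a + (suc m + suc m) ≡ suc (suc (a + (m + m)))
  lemma = solve-∀

⌊/2⌋-< : ∀ m h → m < 2 * h → ⌊ m /2⌋ < h
⌊/2⌋-< m h l = *-cancelˡ-< 2 _ _ (≤-<-trans bound l)
  where
  bound : 2 * ⌊ m /2⌋ ≤ m
  bound = begin
    2 * ⌊ m /2⌋                  ≡⟨ cong (⌊ m /2⌋ +_) (+-identityʳ _) ⟩
    ⌊ m /2⌋ + ⌊ m /2⌋            ≤⟨ m≤n+m _ (b2n (odd m)) ⟩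
    undouble ⌊ m /2⌋ (odd m)     ≡⟨ undouble-half m ⟩
    m                            ∎
    where open ≤-Reasoning

Weigher : ℕ → Set
Weigher n = List (Fin n) → List (Fin n) → Alg n ℕ

-- Every element of M has a unique classmate in R; the bits of the label ℓ of that
-- classmate are the outcomes of weighing M against the elements of R with odd label.
locate : ℕ → ℕ → Weigher n → (Fin n → ℕ) → List (Fin n) → List (Fin n) → Alg n (List ℕ)
locate zero    j W ℓ M R = done (map (λ _ → 0) M)
locate (suc w) j W ℓ M R =
  weighAll j (λ T → W T (filterᵇ (odd ∘ ℓ) R)) M >>= λ bs →
  locate w j W (⌊_/2⌋ ∘ ℓ) M R >>= λ ls →
  done (zipWith undouble ls bs)

pos : List (Fin n) → Fin n → ℕ
pos []      x = 0
pos (y ∷ R) x = if ⌊ y ≟ x ⌋ then 0 else suc (pos R x)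

at : Fin n → List (Fin n) → ℕ → Fin n
at d []      _       = d
at d (y ∷ R) zero    = y
at d (y ∷ R) (suc l) = at d R l

redirect : List (Fin n) → List (Fin n) → List ℕ → Fin n → Fin n
redirect R (y ∷ M) (l ∷ ls) x = if ⌊ y ≟ x ⌋ then at x R l else redirect R M ls x
redirect R _       _        x = x

pick : List A → List Bool → List A
pick (x ∷ L) (b ∷ bs) = if b then x ∷ pick L bs else pick L bs
pick _       _        = []

-- One round of weighing separates the elements of `Y` whose class already occurs in `R`. Only these
-- go through the expensive `locate`; the others become new representatives. The `8 * j` bits
-- suffice because `R` will have at most `2 ^ (8 * j)` elements.
mergeAlg : ℕ → Weigher n → List (Fin n) → List (Fin n) → Alg n (List (Fin n) × (Fin n → Fin n))
mergeAlg j W R Y =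
  weighAll j (λ T → W T R) Y >>= λ bs →
  locate (8 * j) j W (pos R) (pick Y bs) R >>= λ ls →
  done (R ++ pick Y (map not bs) , redirect R (pick Y bs) ls)

pick-map : (v : A → Bool) (L : List A) → pick L (map v L) ≡ filterᵇ v L
pick-map v []      = refl
pick-map v (x ∷ L) with v x
... | true  = cong (x ∷_) (pick-map v L)
... | false = pick-map v L

zipWith-map : {C D : Set} (h : A′ → C → D) (f : A → A′) (g : A → C) (L : List A) →
  zipWith h (map f L) (map g L) ≡ map (λ x → h (f x) (g x)) L
zipWith-map h f g []      = refl
zipWith-map h f g (x ∷ L) = cong (h (f x) (g x) ∷_) (zipWith-map h f g L)

∈-filterᵇ⁻ : (m : A → Bool) (L : List A) {x : A} → x ∈ filterᵇ m L → x ∈ L × m x ≡ true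
∈-filterᵇ⁻ m (y ∷ L) i with m y in e
∈-filterᵇ⁻ m (y ∷ L) (here refl) | true = here refl , e
∈-filterᵇ⁻ m (y ∷ L) (there i)   | true with ∈-filterᵇ⁻ m L i
... | i′ , e′ = there i′ , e′
∈-filterᵇ⁻ m (y ∷ L) i | false with ∈-filterᵇ⁻ m L i
... | i′ , e′ = there i′ , e′

∈-filterᵇ⁺ : (m : A → Bool) (L : List A) {x : A} → x ∈ L → m x ≡ true → x ∈ filterᵇ m L
∈-filterᵇ⁺ m (y ∷ L) (here refl) e rewrite e = here refl
∈-filterᵇ⁺ m (y ∷ L) (there i)   e with m y
... | true  = there (∈-filterᵇ⁺ m L i e)
... | false = ∈-filterᵇ⁺ m L i e

at-pos : (R : List (Fin n)) {x d : Fin n} → x ∈ R → at d R (pos R x) ≡ x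
at-pos (y ∷ R) {x} i with y ≟ x
... | yes e = e
at-pos (y ∷ R) {x} (here e)  | no ne = ⊥-elim (ne (sym e))
at-pos (y ∷ R) {x} (there i) | no ne = at-pos R i

pos-< : (R : List (Fin n)) {x : Fin n} → x ∈ R → pos R x < length R
pos-< (y ∷ R) {x} i with y ≟ x
... | yes e = s≤s z≤n
pos-< (y ∷ R) {x} (here e)  | no ne = ⊥-elim (ne (sym e))
pos-< (y ∷ R) {x} (there i) | no ne = s≤s (pos-< R i)

redirect-spec : (R M : List (Fin n)) (g : Fin n → ℕ) (x : Fin n) →
  (x ∈ M × redirect R M (map g M) x ≡ at x R (g x)) ⊎ (¬ x ∈ M × redirect R M (map g M) x ≡ x)
redirect-spec R []      g x = inj₂ ((λ ()) , refl)
redirect-spec R (y ∷ M) g x with y ≟ x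
... | yes refl = inj₁ (here refl , refl)
... | no ne with redirect-spec R M g x
... | inj₁ (i , e)  = inj₁ (there i , e)
... | inj₂ (ni , e) = inj₂ ((λ { (here e′) → ne (sym e′) ; (there i) → ni i }) , e)

Indep-⊑ : (p : Fin n → Fin k) {S T : List (Fin n)} → S ⊑ T → Indep p T → Indep p S
Indep-⊑ p g h i = ≤-trans (wt-≤ g _) (h i)

0<ᵇ-true : ∀ {m} → 1 ≤ m → (0 <ᵇ m) ≡ true
0<ᵇ-true (s≤s _) = refl

0<ᵇ-true⁻ : ∀ {m} → (0 <ᵇ m) ≡ true → 1 ≤ m
0<ᵇ-true⁻ {suc m} _ = s≤s z≤n

0<ᵇ-false⁻ : ∀ {m} → (0 <ᵇ m) ≡ false → m ≡ 0
0<ᵇ-false⁻ {zero} _ = refl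

hit⁺ : (p : Fin n → Fin k) {Q : List (Fin n)} {x y : Fin n} → x ∈ Q → p x ≡ p y → hit p Q y ≡ true
hit⁺ p {Q} {x} i e = 0<ᵇ-true (subst (λ c → 1 ≤ cnt p c Q) e (cnt-∈ p i))

-- This consults the unknown `p` and therefore belongs to the proof only: the position of the
-- partner is the label that `locate` has to produce.
partner : (p : Fin n → Fin k) (R : List (Fin n)) (y : Fin n) → Fin n
partner p R y with 1 ≤? cnt p (p y) R
... | yes h = proj₁ (wt-find _ R h)
... | no _  = y

partner-spec : (p : Fin n → Fin k) (R : List (Fin n)) (y : Fin n) → hit p R y ≡ true →
  partner p R y ∈ R × p (partner p R y) ≡ p y
partner-spec p R y e with 1 ≤? cnt p (p y) R
... | yes h = let (_ , i , e′) = wt-find _ R h in i , ⌊≟⌋-≡ e′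
... | no nh = ⊥-elim (nh (0<ᵇ-true⁻ e))

not-⊤⊥ : ∀ b → b ≡ true → not b ≡ true → 1 ≤ 0
not-⊤⊥ true _ ()

-- An element already sent into `R` stays where it is, since a merge never discards members of `R`.
-- Any other is first moved within its chunk by `σ′` and then through the merge by `τ`.
combine : List (Fin n) → (σ τ σ′ : Fin n → Fin n) → Fin n → Fin n
combine R σ τ σ′ x = if hit id R (σ x) then σ x else τ (σ′ x)

Solver : ℕ → Set
Solver n = List (Fin n) → Alg n (List (Fin n) × (Fin n → Fin n))

foldChunks : ℕ → Weigher n → Solver n → List (List (Fin n)) → List (Fin n) → (Fin n → Fin n) →
  Alg n (List (Fin n) × (Fin n → Fin n))
foldChunks j W s []       R σ = done (R , σ)
foldChunks j W s (c ∷ cs) R σ =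
  s c >>= λ (Y , σ′) →
  mergeAlg j W R Y >>= λ (R′ , τ) →
  foldChunks j W s cs R′ (combine R σ τ σ′)

-- The sizes grow like 2 ^ 2 ^ i.  At level i a group scheme of order 2 ^ i weighs a chunk
-- with O(1 / 2 ^ i) queries per element, while labels have 8 * 2 ^ i bits, so that
-- each matched element costs O(1) queries; it disappears from the list of
-- representatives, which pays for them.
size : ℕ → ℕ
size zero    = 1
size (suc i) = 2 ^ (8 * 2 ^ i)

solve : Weigher n → ℕ → Solver n
solve W zero    L = done (L , id)
solve W (suc i) L = foldChunks (2 ^ i) W (solve W i) (chunks (size i) L) [] id

-- overhead bounds the queries lost to partially filled groups and chunks, and rate i / 2 ^ i
-- bounds the queries per element.
overhead : ℕ → ℕ
overhead zero    = 0
overhead (suc i) = overhead i + (8 * 2 ^ i + 1) * #q (2 ^ i)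

rate : ℕ → ℕ
rate zero    = 16
rate (suc i) = 2 * (rate i + 146)

-- Arithmetic of sizes, overheads and rates

n<2^n : ∀ m → m < 2 ^ m
n<2^n zero    = s≤s z≤n
n<2^n (suc m) = begin-strict
  suc m              ≤⟨ n<2^n m ⟩
  2 ^ m              <⟨ m<m+n (2 ^ m) (≤-trans (m^n>0 2 m) (≤-reflexive (sym (+-identityʳ _)))) ⟩
  2 * 2 ^ m          ∎
  where open ≤-Reasoning

private
  tower : ℕ → ℕ
  tower i = 2 ^ 2 ^ i

  tower-suc : ∀ i → tower (suc i) ≡ tower i * tower i
  tower-suc i = trans (cong (λ z → 2 ^ (2 ^ i + z)) (+-identityʳ (2 ^ i))) (^-distribˡ-+-* 2 (2 ^ i) (2 ^ i))

  increment-≤ : ∀ i → (8 * 2 ^ i + 1) * #q (2 ^ i) ≤ 18 * (tower i * tower i)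
  increment-≤ i = begin
    (8 * 2 ^ i + 1) * #q (2 ^ i)            ≤⟨ *-mono-≤ (+-monoʳ-≤ (8 * 2 ^ i) (m^n>0 2 i)) (≤-trans (n≤1+n _) (≤-reflexive (#q≡ (2 ^ i)))) ⟩
    (8 * 2 ^ i + 2 ^ i) * (2 * tower i)     ≡⟨ lemma (2 ^ i) (tower i) ⟩
    18 * (2 ^ i * tower i)                  ≤⟨ *-monoʳ-≤ 18 (*-monoˡ-≤ (tower i) (<⇒≤ (n<2^n (2 ^ i)))) ⟩
    18 * (tower i * tower i)                ∎
    where
    open ≤-Reasoning
    lemma : ∀ j t → (8 * j + j) * (2 * t) ≡ 18 * (j * t)
    lemma = solve-∀

  -- The last increment dominates: `tower` squares at each level, so all earlier increments together
  -- fit under one more copy of it, and 36 is twice 18.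
  overhead-≤ : ∀ i → overhead (suc i) ≤ 36 * (tower i * tower i)
  overhead-≤ zero    = ≤-trans (increment-≤ 0) (*-monoˡ-≤ 4 (m≤n+m 18 18))
  overhead-≤ (suc i) = begin
    overhead (suc i) + (8 * 2 ^ suc i + 1) * #q (2 ^ suc i)  ≤⟨ +-mono-≤ (overhead-≤ i) (increment-≤ (suc i)) ⟩
    36 * (tower i * tower i) + 18 * (t * t)                  ≡⟨ cong (λ z → 36 * z + 18 * (t * t)) (tower-suc i) ⟨
    36 * t + 18 * (t * t)                                    ≡⟨ lemma₁ t ⟩
    18 * (2 * t) + 18 * (t * t)                              ≤⟨ +-monoˡ-≤ (18 * (t * t)) (*-monoʳ-≤ 18 (*-monoˡ-≤ t 2≤t)) ⟩
    18 * (t * t) + 18 * (t * t)                              ≡⟨ lemma₂ (t * t) ⟩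
    36 * (t * t)                                             ∎
    where
    open ≤-Reasoning
    t : ℕ
    t = tower (suc i)
    2≤t : 2 ≤ t
    2≤t = ^-monoʳ-≤ 2 {1} {2 ^ suc i} (m^n>0 2 (suc i))
    lemma₁ : ∀ t → 36 * t + 18 * (t * t) ≡ 18 * (2 * t) + 18 * (t * t)
    lemma₁ = solve-∀
    lemma₂ : ∀ t → 18 * t + 18 * t ≡ 36 * t
    lemma₂ = solve-∀

-- This lets a full chunk of `size i` elements absorb its share of the overhead at 144 units per
-- element. The exponent 8 in `size` makes `size (suc i)` the fourth power of `tower (suc i)`,
-- whereas the left side is of the order of its cube. The constant comes from level 0, where the
-- bound is `36 * 4` and the size is 1.
overhead-size : ∀ i → 2 ^ i * overhead (suc i) ≤ 144 * size i
overhead-size zero    = ≤-trans (*-monoʳ-≤ 1 (overhead-≤ 0)) ≤-refl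
overhead-size (suc i) = begin
  2 ^ suc i * overhead (suc (suc i))      ≤⟨ *-mono-≤ (<⇒≤ (n<2^n (2 ^ suc i))) (overhead-≤ (suc i)) ⟩
  t * (36 * (t * t))                      ≡⟨ lemma t ⟩
  36 * (1 * (t * t * t))                  ≤⟨ *-mono-≤ (m≤n+m 36 108) (*-monoˡ-≤ (t * t * t) (m^n>0 2 (2 ^ suc i))) ⟩
  144 * (t * (t * t * t))                 ≡⟨ cong (144 *_) (trans (lemma₄ t) (sym size≡)) ⟩
  144 * size (suc i)                      ∎
  where
  open ≤-Reasoning
  t : ℕ
  t = tower (suc i)
  size≡ : size (suc i) ≡ (t * t) * (t * t)
  size≡ = trans (cong (2 ^_) (exponent (2 ^ i)))
    (trans (^-distribˡ-+-* 2 (2 ^ suc i + 2 ^ suc i) _)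
      (cong₂ _*_ (^-distribˡ-+-* 2 (2 ^ suc i) _) (^-distribˡ-+-* 2 (2 ^ suc i) _)))
    where
    exponent : ∀ j → 8 * j ≡ (2 * j + 2 * j) + (2 * j + 2 * j)
    exponent = solve-∀
  lemma : ∀ t → t * (36 * (t * t)) ≡ 36 * (1 * (t * t * t))
  lemma = solve-∀
  lemma₄ : ∀ t → t * (t * t * t) ≡ (t * t) * (t * t)
  lemma₄ = solve-∀

-- The recurrence doubles `rate i + 292`, which starts at `16 + 292 = 308`.
rate-≤ : ∀ i → rate i ≤ 2 ^ i * 308
rate-≤ i = ≤-trans (m≤m+n (rate i) 292) (≤-reflexive (closed i))
  where
  lemma : ∀ a → 2 * (a + 146) + 292 ≡ 2 * (a + 292)
  lemma = solve-∀
  closed : ∀ i → rate i + 292 ≡ 2 ^ i * 308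
  closed zero    = refl
  closed (suc i) = trans (lemma (rate i)) (trans (cong (2 *_) (closed i)) (sym (*-assoc 2 (2 ^ i) 308)))

1≤size : ∀ i → 1 ≤ size i
1≤size zero    = ≤-refl
1≤size (suc i) = m^n>0 2 (8 * 2 ^ i)

size-< : ∀ i → size i < size (suc i)
size-< zero    = s≤s (s≤s z≤n)
size-< (suc i) = ^-monoʳ-< 2 (s≤s (s≤s z≤n)) (*-monoʳ-< 8 (m<m+n (2 ^ i) (≤-trans (m^n>0 2 i) (m≤m+n _ 0))))

level : ℕ → ℕ
level zero    = 0
level (suc m) with suc m ≤? size (level m)
... | yes _ = level m
... | no _  = suc (level m)

level-size : ∀ m → m ≤ size (level m)
level-size zero    = z≤n
level-size (suc m) with suc m ≤? size (level m)
... | yes h = h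
... | no _  = ≤-<-trans (level-size m) (size-< (level m))

-- The level rises only when the length exceeds the previous size, and that size already bounds the
-- overhead of the new level.
level-overhead : ∀ m → overhead (level m) ≤ 144 * m
level-overhead zero    = z≤n
level-overhead (suc m) with suc m ≤? size (level m)
... | yes _ = ≤-trans (level-overhead m) (*-monoʳ-≤ 144 (n≤1+n m))
... | no nh = begin
  overhead (suc i)              ≡⟨ *-identityˡ _ ⟨
  1 * overhead (suc i)          ≤⟨ *-monoˡ-≤ (overhead (suc i)) (m^n>0 2 i) ⟩
  2 ^ i * overhead (suc i)      ≤⟨ overhead-size i ⟩
  144 * size i                  ≤⟨ *-monoʳ-≤ 144 (<⇒≤ (≰⇒> nh)) ⟩
  144 * suc m                   ∎
  where
  open ≤-Reasoning
  i : ℕ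
  i = level m

partition : Weigher n → Solver n
partition W L = solve W (level (length L)) L

hit-id⁻ : (R : List (Fin n)) {x : Fin n} → hit id R x ≡ true → x ∈ R
hit-id⁻ R {x} e with wt-find (λ y → ⌊ y ≟ x ⌋) R (0<ᵇ-true⁻ e)
... | y , i , e′ = subst (_∈ R) (⌊≟⌋-≡ e′) i

-- Correctness and amortised cost of merging

module Merging (f : Subset n → ℕ) (p : Fin n → Fin k) (D : List (Fin n)) (W : Weigher n)
  -- In both applications `D` has no repetitions, so fitting into `D` together also makes `T` and
  -- `Q` disjoint.
  (W-runs : ∀ T Q → T ++ Q ⊑ D → Indep p T → Indep p Q → Runs f (W T Q) (wt (hit p Q) T) 1) where

  locate-runs : ∀ w j (ℓ g : Fin n → ℕ) (M R : List (Fin n)) → M ++ R ⊑ D → Indep p M → Indep p R →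
    (∀ {y} → y ∈ M → ∃[ x ] (x ∈ R × p x ≡ p y × ℓ x ≡ g y)) →
    (∀ {y} → y ∈ M → g y < 2 ^ w) →
    Runs f (locate w j W ℓ M R) (map g M) (w * weighCost j M)
  locate-runs zero j ℓ g M R d iM iR partners small = cong (_, 0) (map-cong-∈ _ g M λ i → sym (n<1⇒n≡0 (small i)))
  locate-runs (suc w) j ℓ g M R d iM iR partners small =
    subst (Runs f (locate (suc w) j W ℓ M R) (map g M)) (cong (weighCost j M +_) (+-identityʳ _))
     (subst (λ ls → Runs f (locate (suc w) j W ℓ M R) ls _) bits
      (runs-bind (weighAll j (λ T → W T Q) M)
       (weighAll-runs j _ (hit p Q) M λ T g → W-runs T Q (⊑-trans (⊑-++ g Q⊑R) d) (Indep-⊑ p g iM) (Indep-⊑ p Q⊑R iR))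
       (runs-bind (locate w j W (⌊_/2⌋ ∘ ℓ) M R)
         (locate-runs w j (⌊_/2⌋ ∘ ℓ) (⌊_/2⌋ ∘ g) M R d iM iR
           (λ i → let (x , x∈ , e , e′) = partners i in x , x∈ , e , cong ⌊_/2⌋ e′)
           (λ i → ⌊/2⌋-< _ _ (small i))) refl)))
    where
    Q Q̄ : List (Fin n)
    Q = filterᵇ (odd ∘ ℓ) R
    Q̄ = filterᵇ (not ∘ odd ∘ ℓ) R
    Q⊑R : Q ⊑ R
    Q⊑R = filter-⊑ (odd ∘ ℓ) R
    hit-odd : ∀ {y} → y ∈ M → hit p Q y ≡ odd (g y)
    hit-odd {y} i with partners i
    ... | x , x∈ , e , e′ with odd (ℓ x) in eo
    ...   | true  = trans (hit⁺ p (∈-filterᵇ⁺ (odd ∘ ℓ) R x∈ eo) e) (trans (sym eo) (cong odd e′))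
    ...   | false = trans (cong (0 <ᵇ_) (n≤0⇒n≡0 (+-cancelʳ-≤ 1 _ _ none))) (trans (sym eo) (cong odd e′))
      where
      open ≤-Reasoning
      -- The classmate of `y` lies in the even half `Q̄`, and `R` has at most one element of the
      -- class, which leaves none for `Q`.
      none : cnt p (p y) Q + 1 ≤ 0 + 1
      none = begin
        cnt p (p y) Q + 1             ≤⟨ +-monoʳ-≤ (cnt p (p y) Q) (subst (λ c → 1 ≤ cnt p c Q̄) e (cnt-∈ p (∈-filterᵇ⁺ _ R x∈ (cong not eo)))) ⟩
        cnt p (p y) Q + cnt p (p y) Q̄ ≡⟨ cong₂ _+_ (wt-filter (odd ∘ ℓ) _ R) (wt-filter (not ∘ odd ∘ ℓ) _ R) ⟩
        _                             ≡⟨ wt-split (odd ∘ ℓ) _ R ⟩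
        cnt p (p y) R                 ≤⟨ iR (p y) ⟩
        1                             ∎
    bits : zipWith undouble (map (⌊_/2⌋ ∘ g) M) (map (hit p Q) M) ≡ map g M
    bits = trans (zipWith-map undouble (⌊_/2⌋ ∘ g) (hit p Q) M)
      (map-cong-∈ _ g M λ {y} i → trans (cong (undouble ⌊ g y /2⌋) (hit-odd i)) (undouble-half (g y)))

  -- `cost-≤` is amortised, with a potential of `16 * j` per representative. A matched element
  -- ceases to be one and releases exactly the price of its label: `8 * j` rounds at 2 units each.
  -- The first round costs 2 units per element of `Y`, and the last term covers the partly filled
  -- groups of all `8 * j + 1` rounds.
  record Merged (j : ℕ) (R Y : List (Fin n)) (m : Alg n (List (Fin n) × (Fin n → Fin n))) : Set where
    field
      reps    : List (Fin n)
      move    : Fin n → Fin n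
      cost    : ℕ
      runs    : Runs f m (reps , move) cost
      reps⊑   : reps ⊑ R ++ Y
      indep   : Indep p reps
      move-p  : ∀ x → p (move x) ≡ p x
      keeps   : ∀ {x} → x ∈ R → x ∈ reps
      absorbs : ∀ {y} → y ∈ Y → move y ∈ reps
      cost-≤  : j * cost + 16 * j * length reps ≤ 16 * j * (length R + length Y) + 2 * length Y + (8 * j + 1) * (j * #q j)

  merge-spec : ∀ j (R Y : List (Fin n)) → R ++ Y ⊑ D → Indep p R → Indep p Y → length R ≤ 2 ^ (8 * j) →
    Merged j R Y (mergeAlg j W R Y)
  merge-spec j R Y d iR iY short = record
    { reps    = R ++ U
    ; move    = τ
    ; cost    = _
    ; runs    = runs′
    ; reps⊑   = ⊑-++ ⊑-refl U⊑Y
    ; indep   = indep′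
    ; move-p  = move-p′
    ; keeps   = ∈-++⁺ˡ
    ; absorbs = absorbs′
    ; cost-≤  = cost′
    }
    where
    v : Fin n → Bool
    v = hit p R
    M U : List (Fin n)
    M = filterᵇ v Y
    U = filterᵇ (not ∘ v) Y
    g : Fin n → ℕ
    g = pos R ∘ partner p R
    τ : Fin n → Fin n
    τ = redirect R M (map g M)
    M⊑Y : M ⊑ Y
    M⊑Y = filter-⊑ v Y
    U⊑Y : U ⊑ Y
    U⊑Y = filter-⊑ (not ∘ v) Y
    ++-comm-⊑ : (S T : List (Fin n)) → S ++ T ⊑ T ++ S
    ++-comm-⊑ S T = sub λ w → ≤-reflexive (trans (wt-++ w S T) (trans (+-comm (wt w S) _) (sym (wt-++ w T S))))
    M++R⊑D : {T : List (Fin n)} → T ⊑ Y → T ++ R ⊑ D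
    M++R⊑D h = ⊑-trans (⊑-++ h ⊑-refl) (⊑-trans (++-comm-⊑ Y R) d)
    partnered : ∀ {y} → y ∈ M → partner p R y ∈ R × p (partner p R y) ≡ p y
    partnered {y} i = partner-spec p R y (proj₂ (∈-filterᵇ⁻ v Y i))
    locate-M : Runs f (locate (8 * j) j W (pos R) M R) (map g M) (8 * j * weighCost j M)
    locate-M = locate-runs (8 * j) j (pos R) g M R (M++R⊑D M⊑Y) (Indep-⊑ p M⊑Y iY) iR
      (λ {y} i → partner p R y , proj₁ (partnered i) , proj₂ (partnered i) , refl)
      (λ i → <-≤-trans (pos-< R (proj₁ (partnered i))) short)
    rest : ∀ bs → pick Y bs ≡ M → pick Y (map not bs) ≡ U →
      Runs f (locate (8 * j) j W (pos R) (pick Y bs) R >>= λ ls → done (R ++ pick Y (map not bs) , redirect R (pick Y bs) ls))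
        (R ++ U , τ) (8 * j * weighCost j M + 0)
    rest bs e₁ e₂ rewrite e₁ | e₂ = runs-bind (locate (8 * j) j W (pos R) M R) locate-M refl
    runs′ : Runs f (mergeAlg j W R Y) (R ++ U , τ) (weighCost j Y + (8 * j * weighCost j M + 0))
    runs′ = runs-bind (weighAll j (λ T → W T R) Y)
      (weighAll-runs j _ v Y (λ T h → W-runs T R (M++R⊑D h) (Indep-⊑ p h iY) iR))
      (rest (map v Y) (pick-map v Y) (trans (cong (pick Y) (sym (map-∘ Y))) (pick-map (not ∘ v) Y)))
    indep′ : Indep p (R ++ U)
    indep′ i with 1 ≤? cnt p i R
    ... | no z = begin
      cnt p i (R ++ U)       ≡⟨ wt-++ _ R U ⟩
      cnt p i R + cnt p i U  ≡⟨ cong (_+ cnt p i U) (n<1⇒n≡0 (≰⇒> z)) ⟩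
      cnt p i U              ≤⟨ Indep-⊑ p U⊑Y iY i ⟩
      1                      ∎
      where open ≤-Reasoning
    ... | yes h = begin
      cnt p i (R ++ U)       ≡⟨ wt-++ _ R U ⟩
      cnt p i R + cnt p i U  ≡⟨ cong (cnt p i R +_) (wt-none _ U none) ⟩
      cnt p i R + 0          ≡⟨ +-identityʳ _ ⟩
      cnt p i R              ≤⟨ iR i ⟩
      1                      ∎
      where
      open ≤-Reasoning
      none : ∀ {x} → x ∈ U → ⌊ p x ≟ i ⌋ ≡ false
      none {x} x∈ with p x ≟ i
      ... | no _     = refl
      ... | yes refl with () ← not-⊤⊥ (v x) (0<ᵇ-true h) (proj₂ (∈-filterᵇ⁻ (not ∘ v) Y x∈))
    move-p′ : ∀ x → p (τ x) ≡ p x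
    move-p′ x with redirect-spec R M g x
    ... | inj₁ (i , e) = trans (cong p (trans e (at-pos R (proj₁ (partnered i))))) (proj₂ (partnered i))
    ... | inj₂ (_ , e) = cong p e
    absorbs′ : ∀ {y} → y ∈ Y → τ y ∈ R ++ U
    absorbs′ {y} y∈ with redirect-spec R M g y
    ... | inj₁ (i , e) = ∈-++⁺ˡ (subst (_∈ R) (sym (trans e (at-pos R (proj₁ (partnered i))))) (proj₁ (partnered i)))
    ... | inj₂ (ni , e) with v y in ev
    ...   | true  = ⊥-elim (ni (∈-filterᵇ⁺ v Y y∈ ev))
    ...   | false = ∈-++⁺ʳ R (subst (_∈ U) (sym e) (∈-filterᵇ⁺ (not ∘ v) Y y∈ (cong not ev)))
    M+U : length M + length U ≡ length Y
    M+U = begin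
      length M + length U  ≡⟨ cong₂ _+_ (wt-true M) (wt-true U) ⟨
      wt (λ _ → true) M + wt (λ _ → true) U ≡⟨ cong₂ _+_ (wt-filter v _ Y) (wt-filter (not ∘ v) _ Y) ⟩
      _                    ≡⟨ wt-split v (λ _ → true) Y ⟩
      wt (λ _ → true) Y    ≡⟨ wt-true Y ⟩
      length Y             ∎
      where open ≡-Reasoning
    cost′ : j * (weighCost j Y + (8 * j * weighCost j M + 0)) + 16 * j * length (R ++ U)
      ≤ 16 * j * (length R + length Y) + 2 * length Y + (8 * j + 1) * (j * #q j)
    cost′ = begin
      j * (weighCost j Y + (8 * j * weighCost j M + 0)) + 16 * j * length (R ++ U)
        ≡⟨ lemma₁ j (weighCost j Y) (weighCost j M) (length (R ++ U)) ⟩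
      j * weighCost j Y + 8 * j * (j * weighCost j M) + 16 * j * length (R ++ U)
        ≤⟨ +-mono-≤ (+-mono-≤ (weighCost-≤ j Y) (*-monoʳ-≤ (8 * j) (weighCost-≤ j M)))
             (≤-reflexive (cong (16 * j *_) (length-++ R))) ⟩
      (j * #q j + 2 * length Y) + 8 * j * (j * #q j + 2 * length M) + 16 * j * (length R + length U)
        ≡⟨ lemma₂ j (j * #q j) (length Y) (length M) (length R) (length U) ⟩
      16 * j * (length R + (length M + length U)) + 2 * length Y + (8 * j + 1) * (j * #q j)
        ≡⟨ cong (λ z → 16 * j * (length R + z) + 2 * length Y + (8 * j + 1) * (j * #q j)) M+U ⟩
      16 * j * (length R + length Y) + 2 * length Y + (8 * j + 1) * (j * #q j) ∎
      where
      open ≤-Reasoning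
      lemma₁ : ∀ j a b c → j * (a + (8 * j * b + 0)) + 16 * j * c ≡ j * a + 8 * j * (j * b) + 16 * j * c
      lemma₁ = solve-∀
      lemma₂ : ∀ j q y m r u → (q + 2 * y) + 8 * j * (q + 2 * m) + 16 * j * (r + u)
        ≡ 16 * j * (r + (m + u)) + 2 * y + (8 * j + 1) * q
      lemma₂ = solve-∀

  record Solved (j a e : ℕ) (L : List (Fin n)) (m : Alg n (List (Fin n) × (Fin n → Fin n))) : Set where
    field
      reps    : List (Fin n)
      move    : Fin n → Fin n
      cost    : ℕ
      runs    : Runs f m (reps , move) cost
      reps⊑   : reps ⊑ L
      indep   : Indep p reps
      move-p  : ∀ x → p (move x) ≡ p x
      covers  : ∀ {x} → x ∈ L → move x ∈ reps
      cost-≤  : j * cost + 16 * j * length reps ≤ a * length L + j * e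

  record Folded (j a e : ℕ) (cs : List (List (Fin n))) (R : List (Fin n)) (σ : Fin n → Fin n)
    (m : Alg n (List (Fin n) × (Fin n → Fin n))) : Set where
    field
      reps    : List (Fin n)
      move    : Fin n → Fin n
      cost    : ℕ
      runs    : Runs f m (reps , move) cost
      reps⊑   : reps ⊑ R ++ concat cs
      indep   : Indep p reps
      move-p  : ∀ x → p (move x) ≡ p x
      keeps   : ∀ x → σ x ∈ R → move x ∈ reps
      covers  : ∀ {x} → x ∈ concat cs → move x ∈ reps
      cost-≤  : j * cost + 16 * j * length reps
                ≤ 16 * j * length R + (a + 2) * length (concat cs) + length cs * (j * e + (8 * j + 1) * (j * #q j))

  -- The multiset `R ++ concat cs` can only shrink from one chunk to the next. This carries both the
  -- inclusion in `D` and the bound on the labels through the induction.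
  fold-spec : ∀ j a e N (s : Solver n) → (∀ L → L ⊑ D → length L ≤ N → Solved j a e L (s L)) →
    ∀ cs R σ → All (λ c → length c ≤ N) cs → R ++ concat cs ⊑ D → length (R ++ concat cs) ≤ 2 ^ (8 * j) →
    Indep p R → (∀ x → p (σ x) ≡ p x) → Folded j a e cs R σ (foldChunks j W s cs R σ)
  fold-spec j a e N s solved [] R σ _ d short iR pσ = record
    { reps = R ; move = σ ; cost = 0 ; runs = refl
    ; reps⊑ = ⊑-++ˡ R [] ; indep = iR ; move-p = pσ ; keeps = λ _ i → i ; covers = λ ()
    ; cost-≤ = ≤-reflexive (lemma j a (length R)) }
    where
    lemma : ∀ j a r → j * 0 + 16 * j * r ≡ 16 * j * r + (a + 2) * 0 + 0
    lemma = solve-∀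
  fold-spec j a e N s solved (c ∷ cs) R σ (h ∷ hs) d short iR pσ = record
    { reps    = F.reps
    ; move    = F.move
    ; cost    = S.cost + (M.cost + F.cost)
    ; runs    = runs-bind (s c) S.runs (runs-bind (mergeAlg j W R S.reps) M.runs F.runs)
    ; reps⊑   = ⊑-trans F.reps⊑ next⊑
    ; indep   = F.indep
    ; move-p  = F.move-p
    ; keeps   = λ x i → F.keeps x (kept x i)
    ; covers  = covers′
    ; cost-≤  = cost′
    }
    where
    module S = Solved (solved c (⊑-trans (⊑-trans (⊑-++ˡ c (concat cs)) (⊑-++ʳ R _)) d) h)
    R++Y⊑ : R ++ S.reps ⊑ R ++ (c ++ concat cs)
    R++Y⊑ = ⊑-++ (⊑-refl {S = R}) (⊑-trans S.reps⊑ (⊑-++ˡ c (concat cs)))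
    module M = Merged (merge-spec j R S.reps (⊑-trans R++Y⊑ d) iR S.indep
      (≤-trans (⊑-length (⊑-++ˡ R _)) short))
    σ′ : Fin n → Fin n
    σ′ = combine R σ M.move S.move
    next⊑ : M.reps ++ concat cs ⊑ R ++ (c ++ concat cs)
    next⊑ = subst (M.reps ++ concat cs ⊑_) (++-assoc R c (concat cs))
      (⊑-++ (⊑-trans M.reps⊑ (⊑-++ (⊑-refl {S = R}) S.reps⊑)) ⊑-refl)
    pσ′ : ∀ x → p (σ′ x) ≡ p x
    pσ′ x with hit id R (σ x)
    ... | true  = pσ x
    ... | false = trans (M.move-p _) (S.move-p x)
    module F = Folded (fold-spec j a e N s solved cs M.reps σ′ hs (⊑-trans next⊑ d)
      (≤-trans (⊑-length next⊑) short) M.indep pσ′)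
    kept : ∀ x → σ x ∈ R → σ′ x ∈ M.reps
    kept x i with hit id R (σ x) | hit⁺ id i refl
    ... | true | _ = M.keeps i
    new : ∀ {x} → x ∈ c → σ′ x ∈ M.reps
    new {x} i with hit id R (σ x) in eh
    ... | true  = M.keeps (hit-id⁻ R eh)
    ... | false = M.absorbs (S.covers i)
    covers′ : ∀ {x} → x ∈ c ++ concat cs → F.move x ∈ F.reps
    covers′ {x} i with ∈-++⁻ c i
    ... | inj₁ i′ = F.keeps x (new i′)
    ... | inj₂ i′ = F.covers i′
    K : ℕ
    K = (8 * j + 1) * (j * #q j)
    cost′ : j * (S.cost + (M.cost + F.cost)) + 16 * j * length F.reps
      ≤ 16 * j * length R + (a + 2) * length (c ++ concat cs) + suc (length cs) * (j * e + K)
    -- The potentials of the intermediate representatives are released by one bound and required by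
    -- another. Adding them to both sides and cancelling at the end avoids subtraction.
    cost′ = +-cancelʳ-≤ (16 * j * length M.reps + 16 * j * length S.reps) _ _ (begin
      j * (S.cost + (M.cost + F.cost)) + 16 * j * length F.reps + (16 * j * length M.reps + 16 * j * length S.reps)
        ≡⟨ lemma₁ j S.cost M.cost F.cost (16 * j * length F.reps) (16 * j * length M.reps) (16 * j * length S.reps) ⟩
      (j * S.cost + 16 * j * length S.reps) + (j * M.cost + 16 * j * length M.reps) + (j * F.cost + 16 * j * length F.reps)
        ≤⟨ +-mono-≤ (+-mono-≤ S.cost-≤ (≤-trans M.cost-≤ (+-monoˡ-≤ K (+-monoʳ-≤ (16 * j * (length R + length S.reps)) (*-monoʳ-≤ 2 (⊑-length S.reps⊑)))))) F.cost-≤ ⟩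
      (a * length c + j * e) + (16 * j * (length R + length S.reps) + 2 * length c + K)
        + (16 * j * length M.reps + (a + 2) * length (concat cs) + length cs * (j * e + K))
        ≡⟨ lemma₂ j a e (length c) (length R) (length S.reps) (length M.reps) (length (concat cs)) (length cs) K ⟩
      16 * j * length R + (a + 2) * (length c + length (concat cs)) + suc (length cs) * (j * e + K)
        + (16 * j * length M.reps + 16 * j * length S.reps)
        ≡⟨ cong (λ z → 16 * j * length R + (a + 2) * z + suc (length cs) * (j * e + K) + (16 * j * length M.reps + 16 * j * length S.reps)) (length-++ c) ⟨
      16 * j * length R + (a + 2) * length (c ++ concat cs) + suc (length cs) * (j * e + K)
        + (16 * j * length M.reps + 16 * j * length S.reps) ∎)
      where
      open ≤-Reasoning
      lemma₁ : ∀ j x y z a b c → j * (x + (y + z)) + a + (b + c) ≡ (j * x + c) + (j * y + b) + (j * z + a)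
      lemma₁ = solve-∀
      lemma₂ : ∀ j a e c r s m l g K → (a * c + j * e) + (16 * j * (r + s) + 2 * c + K) + (16 * j * m + (a + 2) * l + g * (j * e + K))
        ≡ 16 * j * r + (a + 2) * (c + l) + suc g * (j * e + K) + (16 * j * m + 16 * j * s)
      lemma₂ = solve-∀

  solve-spec : ∀ i L → L ⊑ D → length L ≤ size i → Solved (2 ^ i) (rate i) (overhead i) L (solve W i L)
  solve-spec zero L d h = record
    { reps = L ; move = id ; cost = 0 ; runs = refl ; reps⊑ = ⊑-refl
    ; indep = λ i → ≤-trans (wt≤length _ L) h
    ; move-p = λ _ → refl ; covers = id
    -- No query is made, and the potential of the elements is exactly what `rate 0 = 16` provides.
    ; cost-≤ = ≤-reflexive (sym (+-identityʳ _)) }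
  solve-spec (suc i) L d h = record
    { reps    = F.reps
    ; move    = F.move
    ; cost    = F.cost
    ; runs    = F.runs
    ; reps⊑   = subst (F.reps ⊑_) whole F.reps⊑
    ; indep   = F.indep
    ; move-p  = F.move-p
    ; covers  = λ {x} x∈ → F.covers (subst (x ∈_) (sym whole) x∈)
    ; cost-≤  = cost′
    }
    where
    j N : ℕ
    j = 2 ^ i
    N = size i
    cs : List (List (Fin n))
    cs = chunks N L
    whole : concat cs ≡ L
    whole = chunks-concat N L
    module F = Folded (fold-spec j (rate i) (overhead i) N (solve W i) (solve-spec i) cs [] id
      (chunks-short N L (1≤size i)) (subst (_⊑ D) (sym whole) d)
      (≤-trans (≤-reflexive (cong length whole)) h) (λ _ → z≤n) (λ _ → refl))
    P : ℕ
    P = j * overhead i + (8 * j + 1) * (j * #q j)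
    P≡ : P ≡ j * overhead (suc i)
    P≡ = lemma j (overhead i) (#q j)
      where
      lemma : ∀ j e q → j * e + (8 * j + 1) * (j * q) ≡ j * (e + (8 * j + 1) * q)
      lemma = solve-∀
    -- The `g` full chunks pay their overhead `P ≤ 144 * N` themselves, which with the 2 units for
    -- merging gives the 146 in `rate`. The overhead of the last chunk stays as the additive term.
    cost₁ : j * F.cost + 16 * j * length F.reps ≤ (rate i + 146) * length L + j * overhead (suc i)
    cost₁ with chunks-count N L
    ... | g , eg , gN = begin
      j * F.cost + 16 * j * length F.reps                      ≤⟨ F.cost-≤ ⟩
      16 * j * 0 + (rate i + 2) * length (concat cs) + length cs * P
        ≡⟨ cong₂ (λ y z → 16 * j * 0 + (rate i + 2) * y + z * P) (cong length whole) eg ⟩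
      16 * j * 0 + (rate i + 2) * length L + suc g * P         ≡⟨ lemma₁ j (rate i) (length L) g P ⟩
      (rate i + 2) * length L + P + g * P                      ≤⟨ +-monoʳ-≤ ((rate i + 2) * length L + P) (*-monoʳ-≤ g (≤-trans (≤-reflexive P≡) (overhead-size i))) ⟩
      (rate i + 2) * length L + P + g * (144 * N)              ≡⟨ lemma₂ (rate i) (length L) g P N ⟩
      (rate i + 2) * length L + P + 144 * (g * N)              ≤⟨ +-monoʳ-≤ ((rate i + 2) * length L + P) (*-monoʳ-≤ 144 gN) ⟩
      (rate i + 2) * length L + P + 144 * length L             ≡⟨ lemma₃ (rate i) (length L) P ⟩
      (rate i + 146) * length L + P                            ≡⟨ cong ((rate i + 146) * length L +_) P≡ ⟩
      (rate i + 146) * length L + j * overhead (suc i)         ∎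
      where
      open ≤-Reasoning
      lemma₁ : ∀ j a l g P → 16 * j * 0 + (a + 2) * l + suc g * P ≡ (a + 2) * l + P + g * P
      lemma₁ = solve-∀
      lemma₂ : ∀ a l g P N → (a + 2) * l + P + g * (144 * N) ≡ (a + 2) * l + P + 144 * (g * N)
      lemma₂ = solve-∀
      lemma₃ : ∀ a l P → (a + 2) * l + P + 144 * l ≡ (a + 146) * l + P
      lemma₃ = solve-∀
    -- The next level measures in units of `1 / (2 * j)`, so the inequality is doubled; hence the
    -- factor 2 in `rate`.
    cost′ : 2 ^ suc i * F.cost + 16 * 2 ^ suc i * length F.reps ≤ rate (suc i) * length L + 2 ^ suc i * overhead (suc i)
    cost′ = begin
      2 * j * F.cost + 16 * (2 * j) * length F.reps                 ≡⟨ lemma₁ j F.cost (length F.reps) ⟩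
      2 * (j * F.cost + 16 * j * length F.reps)                     ≤⟨ *-monoʳ-≤ 2 cost₁ ⟩
      2 * ((rate i + 146) * length L + j * overhead (suc i))        ≡⟨ lemma₂ j (rate i) (length L) (overhead (suc i)) ⟩
      2 * (rate i + 146) * length L + 2 * j * overhead (suc i)      ∎
      where
      open ≤-Reasoning
      lemma₁ : ∀ j c r → 2 * j * c + 16 * (2 * j) * r ≡ 2 * (j * c + 16 * j * r)
      lemma₁ = solve-∀
      lemma₂ : ∀ j a l e → 2 * ((a + 146) * l + j * e) ≡ 2 * (a + 146) * l + 2 * j * e
      lemma₂ = solve-∀

  record Partitioned (L : List (Fin n)) (m : Alg n (List (Fin n) × (Fin n → Fin n))) : Set where
    field
      reps    : List (Fin n)
      move    : Fin n → Fin n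
      cost    : ℕ
      runs    : Runs f m (reps , move) cost
      indep   : Indep p reps
      move-p  : ∀ x → p (move x) ≡ p x
      covers  : ∀ {x} → x ∈ L → move x ∈ reps
      cost-≤  : cost ≤ 452 * length L

  partition-spec : ∀ L → L ⊑ D → Partitioned L (partition W L)
  partition-spec L d = record
    { reps = S.reps ; move = S.move ; cost = S.cost ; runs = S.runs ; indep = S.indep ; move-p = S.move-p ; covers = S.covers
    -- The remaining potential is dropped and `j` divided out; 452 is 308 from `rate-≤` plus 144
    -- from `level-overhead`.
    ; cost-≤ = *-cancelˡ-≤ j {{m^n≢0 2 i}} (begin
      j * S.cost                                            ≤⟨ m≤m+n _ _ ⟩
      j * S.cost + 16 * j * length S.reps                   ≤⟨ S.cost-≤ ⟩
      rate i * length L + j * overhead i                    ≤⟨ +-mono-≤ (*-monoˡ-≤ (length L) (rate-≤ i)) (*-monoʳ-≤ j (level-overhead (length L))) ⟩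
      j * 308 * length L + j * (144 * length L)             ≡⟨ lemma j (length L) ⟩
      j * (452 * length L)                                  ∎) }
    where
    open ≤-Reasoning
    i j : ℕ
    i = level (length L)
    j = 2 ^ i
    module S = Solved (solve-spec i L d (level-size (length L)))
    lemma : ∀ j l → j * 308 * l + j * (144 * l) ≡ j * (452 * l)
    lemma = solve-∀

-- Reduction to unit capacities

free? : Fin n → List (Fin n) → Alg n Bool
free? y S = ask ⟦ y ∷ S ⟧ (λ a → done (a ≡ᵇ suc (length S)))

basis : List (Fin n) → List (Fin n) → List (Fin n) → Alg n (List (Fin n) × List (Fin n))
basis B N []      = done (B , N)
basis B N (x ∷ L) = free? x B >>= λ b → if b then basis (x ∷ B) N L else basis B (x ∷ N) L

-- Binary search for a basis element that `y` can replace. The part of `y` is saturated, so omitting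
-- half of the candidates `H` makes room for `y` exactly when that half contains an element of the
-- part.
search : ℕ → Fin n → List (Fin n) → List (Fin n) → Alg n (List (Fin n) × List (Fin n))
search zero    y H Z = done (H , Z)
search (suc d) y H Z = free? y (drop (2 ^ d) H ++ Z) >>= λ b →
  if b then search d y (take (2 ^ d) H) (drop (2 ^ d) H ++ Z)
       else search d y (drop (2 ^ d) H) (take (2 ^ d) H ++ Z)

-- The element found by `search` leaves the working basis, so every later `y` of the same part is
-- free over it and is skipped after one query. Thus each part causes a single binary search.
transversal : ℕ → List (Fin n) → List (Fin n) → List (Fin n) → List (Fin n) →
  Alg n (List (Fin n) × List (Fin n) × List (Fin n))
transversal d []      B X Y = done (B , X , Y)
transversal d (y ∷ N) B X Y = free? y B >>= λ b →
  if b then transversal d N B X Y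
       else (search d y B [] >>= λ (H , Z) → transversal d N Z (H ++ X) (y ∷ Y))

remove : Fin n → List (Fin n) → List (Fin n)
remove x []      = []
remove x (y ∷ L) = if ⌊ y ≟ x ⌋ then L else y ∷ remove x L

minus : List (Fin n) → List (Fin n) → List (Fin n)
minus D []      = D
minus D (x ∷ S) = minus (remove x D) S

-- contracted weighs in the matroid obtained by contracting all but one basis element of each
-- part, deleted in the dual of the restriction to the basis and one more element
-- of each part.  Both matroids have capacity 1 on every part.
contracted : List (Fin n) → Weigher n
contracted B T Q = ask ⟦ (T ++ Q) ++ B ⟧ (λ a → done (length ((T ++ Q) ++ B) ∸ a))

deleted : ℕ → List (Fin n) → Weigher n
deleted b D T Q = ask ⟦ minus D (T ++ Q) ⟧ (λ a → done (b ∸ a))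

preimage : (Fin n → Fin n) → List (Fin n) → Fin n → Fin n
preimage σ []      z = z
preimage σ (y ∷ Y) z = if ⌊ σ y ≟ z ⌋ then y else preimage σ Y z

-- Y has one element of each part, and these lie in the domains of both partitions.
link : List (Fin n) → List (Fin n) → (σ₁ σ₂ : Fin n → Fin n) → Fin n → Fin n
link B Y σ₁ σ₂ x = if hit id B x then σ₁ (preimage σ₂ Y (σ₂ x)) else σ₁ x

-- A class is named by the position of its representative in `R`. Its capacity is the number of
-- basis elements in it, since the basis saturates every part. The fallback output only makes the
-- function total.
assemble : List (Fin n) → (Fin n → Fin n) → List (Fin n) → Output n
assemble {n} R ρ B with all? (λ x → any? (ρ x ≟_) R)
... | yes h = length R , (λ x → index (h x)) , λ j → wt (λ x → ⌊ index (h x) ≟ j ⌋) B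
... | no _  = n , id , λ _ → 0

learn : ∀ n → Alg n (Output n)
learn n =
  basis [] [] (allFin n) >>= λ (B , N) →
  transversal ⌈log₂ length B ⌉ N B [] [] >>= λ (B′ , X , Y) →
  partition (contracted B′) (X ++ N) >>= λ (R , σ₁) →
  partition (deleted (length B) (B ++ Y)) (B ++ Y) >>= λ (_ , σ₂) →
  done (assemble R (link B Y σ₁ σ₂) B)

-- Auxiliary facts on logarithms, multisets and minima

≤2^⌈log₂⌉ : ∀ m → m ≤ 2 ^ ⌈log₂ m ⌉
≤2^⌈log₂⌉ = <-rec _ step
  where
  ≤2*half : ∀ m → m ≤ 2 * ⌈ m /2⌉
  ≤2*half m = begin
    m                    ≡⟨ ⌊n/2⌋+⌈n/2⌉≡n m ⟨
    ⌊ m /2⌋ + ⌈ m /2⌉    ≤⟨ +-mono-≤ (⌊n/2⌋≤⌈n/2⌉ m) (m≤m+n ⌈ m /2⌉ 0) ⟩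
    2 * ⌈ m /2⌉          ∎
    where open ≤-Reasoning
  step : ∀ m → (∀ {l} → l < m → l ≤ 2 ^ ⌈log₂ l ⌉) → m ≤ 2 ^ ⌈log₂ m ⌉
  step zero          rec = z≤n
  step (suc zero)    rec = m^n>0 2 ⌈log₂ 1 ⌉
  step (suc (suc m)) rec = begin
    M                          ≤⟨ ≤2*half M ⟩
    2 * ⌈ M /2⌉                ≤⟨ *-monoʳ-≤ 2 (rec (⌈n/2⌉<n m)) ⟩
    2 * 2 ^ ⌈log₂ ⌈ M /2⌉ ⌉    ≡⟨ cong (λ z → 2 * 2 ^ z) (⌈log₂⌈n/2⌉⌉≡⌈log₂n⌉∸1 M) ⟩
    2 ^ suc (⌈log₂ M ⌉ ∸ 1)    ≡⟨ cong (2 ^_) (m+[n∸m]≡n (⌈log₂⌉-mono-≤ {2} {M} (s≤s (s≤s z≤n)))) ⟩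
    2 ^ ⌈log₂ M ⌉              ∎
    where
    open ≤-Reasoning
    M : ℕ
    M = suc (suc m)

T⇒≡ : ∀ {b} → T b → b ≡ true
T⇒≡ {true} _ = refl

≡⇒T : ∀ {b} → b ≡ true → T b
≡⇒T refl = _

<ᵇ-true : ∀ {l m} → l < m → (l <ᵇ m) ≡ true
<ᵇ-true h = T⇒≡ (<⇒<ᵇ h)

<ᵇ-true⁻ : ∀ {l m} → (l <ᵇ m) ≡ true → l < m
<ᵇ-true⁻ {l} {m} e = <ᵇ⇒< l m (≡⇒T e)

<ᵇ-false⁻ : ∀ {l m} → (l <ᵇ m) ≡ false → m ≤ l
<ᵇ-false⁻ {l} {m} e = ≮⇒≥ λ h → case-⊥ (trans (sym e) (<ᵇ-true h))
  where
  case-⊥ : ∀ {X : Set} → false ≡ true → X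
  case-⊥ ()

⇔⇒≡ : ∀ {b c} → (b ≡ true → c ≡ true) → (c ≡ true → b ≡ true) → b ≡ c
⇔⇒≡ {true}  {c}     g h = sym (g refl)
⇔⇒≡ {false} {false} g h = refl
⇔⇒≡ {false} {true}  g h = h refl

wt-tabulate : ∀ {m} (v : A → Bool) (g : Fin m → A) → wt v (tabulate g) ≡ ∑ (b2n ∘ v ∘ g)
wt-tabulate {m = zero}  v g = refl
wt-tabulate {m = suc m} v g = cong (b2n (v (g zero)) +_) (wt-tabulate v (g ∘ suc))

∣tabulate∣ : ∀ {m} (v : Fin m → Bool) → ∣ Vec.tabulate v ∣ ≡ ∑ (b2n ∘ v)
∣tabulate∣ {zero}  v = refl
∣tabulate∣ {suc m} v with v zero
... | true  = cong suc (∣tabulate∣ (v ∘ suc))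
... | false = ∣tabulate∣ (v ∘ suc)

⌊≟⌋-sym : (i j : Fin k) → ⌊ i ≟ j ⌋ ≡ ⌊ j ≟ i ⌋
⌊≟⌋-sym i j = ⇔⇒≡ (λ e → trans (cong (λ z → ⌊ z ≟ i ⌋) (sym (⌊≟⌋-≡ e))) (⌊≟⌋-refl i))
                  (λ e → trans (cong (λ z → ⌊ z ≟ j ⌋) (sym (⌊≟⌋-≡ e))) (⌊≟⌋-refl j))

mult-allFin : (x : Fin n) → cnt id x (allFin n) ≡ 1
mult-allFin x = trans (wt-tabulate (λ y → ⌊ y ≟ x ⌋) id)
  (trans (∑-cong (λ y → trans (cong b2n (⌊≟⌋-sym y x)) (sym (*-identityʳ _)))) (∑-δ x (λ _ → 1)))

wt-remove : (v : Fin n → Bool) {x : Fin n} {L : List (Fin n)} → x ∈ L → b2n (v x) + wt v (remove x L) ≡ wt v L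
wt-remove v {x} {y ∷ L} i with y ≟ x
... | yes refl = refl
wt-remove v {x} {y ∷ L} (here e)  | no ne = ⊥-elim (ne (sym e))
wt-remove v {x} {y ∷ L} (there i) | no ne = trans (+-swap (b2n (v x)) (b2n (v y)) _) (cong (b2n (v y) +_) (wt-remove v i))

wt-minus : (S : List (Fin n)) {D : List (Fin n)} → S ⊑ D → ∀ v → wt v (minus D S) + wt v S ≡ wt v D
wt-minus []      h v = +-identityʳ _
wt-minus (x ∷ S) {D} h v = begin
  wt v (minus (remove x D) S) + (b2n (v x) + wt v S)  ≡⟨ +-swap (wt v (minus (remove x D) S)) (b2n (v x)) (wt v S) ⟩
  b2n (v x) + (wt v (minus (remove x D) S) + wt v S)  ≡⟨ cong (b2n (v x) +_) (wt-minus S S⊑ v) ⟩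
  b2n (v x) + wt v (remove x D)                       ≡⟨ wt-remove v x∈ ⟩
  wt v D                                              ∎
  where
  open ≡-Reasoning
  x∈ : x ∈ D
  x∈ = ⊑⇒⊆ h (here refl)
  S⊑ : S ⊑ remove x D
  S⊑ = sub λ w → +-cancelˡ-≤ (b2n (w x)) _ _ (≤-trans (wt-≤ h w) (≤-reflexive (sym (wt-remove w x∈))))

lookup-injective : (p : Fin n → Fin k) (R : List (Fin n)) → Indep p R →
  ∀ a b → p (lookup R a) ≡ p (lookup R b) → a ≡ b
lookup-injective p (x ∷ R) h zero    zero    e = refl
lookup-injective p (x ∷ R) h (suc a) (suc b) e =
  cong suc (lookup-injective p R (λ i → ≤-trans (m≤n+m _ (b2n ⌊ p x ≟ i ⌋)) (h i)) a b e)
lookup-injective p (x ∷ R) h zero    (suc b) e = ⊥-elim (distinct p x R b h e)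
  where
  distinct : (p : Fin n → Fin k) (x : Fin n) (R : List (Fin n)) (b : Fin (length R)) → Indep p (x ∷ R) → p x ≢ p (lookup R b)
  distinct p x R b h e = 1+n≰n (≤-trans (+-mono-≤ (≤-reflexive (cong b2n (sym (⌊≟⌋-refl (p x)))))
    (subst (λ c → 1 ≤ cnt p c R) (sym e) (cnt-∈ p (∈-lookup {xs = R} b)))) (h (p x)))
lookup-injective p (x ∷ R) h (suc a) zero    e = sym (lookup-injective p (x ∷ R) h zero (suc a) (sym e))

Indep-unique : (p : Fin n → Fin k) {R : List (Fin n)} {x y : Fin n} → Indep p R → x ∈ R → y ∈ R → p x ≡ p y → x ≡ y
Indep-unique p {R} h i j e = trans (lookup-index i) (trans (cong (lookup R)
  (lookup-injective p R h (index i) (index j) (trans (cong p (sym (lookup-index i))) (trans e (cong p (lookup-index j))))))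
  (sym (lookup-index j)))

preimage-spec : (σ : Fin n → Fin n) (Y : List (Fin n)) {y z : Fin n} → y ∈ Y → σ y ≡ z →
  preimage σ Y z ∈ Y × σ (preimage σ Y z) ≡ z
preimage-spec σ (x ∷ Y) {y} {z} i e with σ x ≟ z
... | yes e′ = here refl , e′
preimage-spec σ (x ∷ Y) (here refl) e | no ne = ⊥-elim (ne e)
preimage-spec σ (x ∷ Y) (there i)   e | no ne = let (i′ , e′) = preimage-spec σ Y i e in there i′ , e′

-- The `b` elements leave room for one more, so an element is lost only if both `T` and `Q`
-- contribute one, that is if `t * q` is 1.
⊓-contract : ∀ {t q b r} → t ≤ 1 → q ≤ 1 → b + 1 ≡ r → (t + q + b) ⊓ r + t * q ≡ t + q + b
⊓-contract {b = b} z≤n       z≤n       refl = trans (+-identityʳ _) (m≤n⇒m⊓n≡m (m≤m+n b 1))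
⊓-contract {b = b} z≤n       (s≤s z≤n) refl = trans (+-identityʳ _) (m≤n⇒m⊓n≡m (≤-reflexive (+-comm 1 b)))
⊓-contract {b = b} (s≤s z≤n) z≤n       refl = trans (+-identityʳ _) (m≤n⇒m⊓n≡m (≤-reflexive (+-comm 1 b)))
⊓-contract {b = b} (s≤s z≤n) (s≤s z≤n) refl =
  trans (cong (_+ 1) (m≥n⇒m⊓n≡n (≤-trans (≤-reflexive (+-comm b 1)) (n≤1+n _)))) (trans (+-comm _ 1) (cong suc (+-comm b 1)))

-- With `r + 1` elements present the first deletion is free and the second lowers the rank by one.
⊓-delete : ∀ {t q w r} → t ≤ 1 → q ≤ 1 → w + (t + q) ≡ r + 1 → w ⊓ r + t * q ≡ r
⊓-delete {w = w} {r} z≤n       z≤n       e = trans (+-identityʳ _) (m≥n⇒m⊓n≡n (≤-trans (m≤m+n r 1) (≤-reflexive (trans (sym e) (+-identityʳ w)))))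
⊓-delete {w = w} {r} z≤n       (s≤s z≤n) e rewrite +-cancelʳ-≡ 1 w r e = trans (+-identityʳ _) (⊓-idem r)
⊓-delete {w = w} {r} (s≤s z≤n) z≤n       e rewrite +-cancelʳ-≡ 1 w r e = trans (+-identityʳ _) (⊓-idem r)
⊓-delete {w = w} {r} (s≤s z≤n) (s≤s z≤n) e = trans (cong (_+ 1) (m≤n⇒m⊓n≡m (≤-trans (m≤m+n w 1) (≤-reflexive w+1)))) w+1
  where
  w+1 : w + 1 ≡ r
  w+1 = +-cancelʳ-≡ 1 (w + 1) r (trans (+-assoc w 1 1) e)

runs-if : {f : Subset n → ℕ} (m : Alg n Bool) {t e : Alg n A} {b : Bool} {a : A} {c d : ℕ} →
  Runs f m b c → Runs f (if b then t else e) a d → Runs f (m >>= λ b → if b then t else e) a (c + d)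
runs-if m h h′ = runs-bind m h h′

-- Correctness of the stages for a fixed matroid

module Learning (p : Fin n → Fin k) (r : Fin k → ℕ) (valid : ValidCaps p r) where

  f : Subset n → ℕ
  f = rank p r

  V : List (Fin n)
  V = allFin n

  Uniq-⊑V : {S : List (Fin n)} → S ⊑ V → Uniq S
  Uniq-⊑V h x = ≤-trans (wt-≤ h _) (≤-reflexive (mult-allFin x))

  cnt-V : ∀ i → cnt p i V ≡ ∣ Part p i ∣
  cnt-V i = trans (wt-tabulate (λ x → ⌊ p x ≟ i ⌋) id) (sym (∣tabulate∣ (λ x → ⌊ p x ≟ i ⌋)))

  -- All other classes are within capacity by hypothesis, so the rank reaches the cardinality just
  -- when the class of `y` has room.
  free?-runs : ∀ y S → y ∷ S ⊑ V → (∀ i → cnt p i S ≤ r i) → Runs f (free? y S) (cnt p (p y) S <ᵇ r (p y)) 1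
  free?-runs y S d h = cong (_, 1) (⇔⇒≡ dependent independent)
    where
    c : Fin k → ℕ
    c i = cnt p i (y ∷ S)
    rank≡ : f ⟦ y ∷ S ⟧ ≡ ∑ (λ i → c i ⊓ r i)
    rank≡ = rank-⟦⟧ p r (y ∷ S) (Uniq-⊑V d)
    c-py : c (p y) ≡ suc (cnt p (p y) S)
    c-py = cong (λ b → b2n b + cnt p (p y) S) (⌊≟⌋-refl (p y))
    dependent : (f ⟦ y ∷ S ⟧ ≡ᵇ suc (length S)) ≡ true → (cnt p (p y) S <ᵇ r (p y)) ≡ true
    dependent e = <ᵇ-true (≤-trans (≤-reflexive (sym c-py)) (m⊓n≡m⇒m≤n
      (∑-≤-≡ (λ i → m⊓n≤m (c i) (r i)) (trans (sym rank≡) (trans (≡ᵇ⇒≡ _ _ (≡⇒T e)) (sym (∑-cnt p (y ∷ S))))) (p y))))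
    independent : (cnt p (p y) S <ᵇ r (p y)) ≡ true → (f ⟦ y ∷ S ⟧ ≡ᵇ suc (length S)) ≡ true
    independent e = T⇒≡ (≡⇒≡ᵇ _ _ (trans rank≡ (trans (∑-cong (λ i → m≤n⇒m⊓n≡m (c≤r i))) (∑-cnt p (y ∷ S)))))
      where
      c≤r : ∀ i → c i ≤ r i
      c≤r i with p y ≟ i
      ... | yes refl = <ᵇ-true⁻ e
      ... | no _     = h i

  record Basis (m : Alg n (List (Fin n) × List (Fin n))) (cost : ℕ) : Set where
    field
      ins      : List (Fin n)
      outs     : List (Fin n)
      runs     : Runs f m (ins , outs) cost
      total    : ∀ v → wt v ins + wt v outs ≡ wt v V
      bounded  : ∀ i → cnt p i ins ≤ r i
      spanning : ∀ {x} → x ∈ outs → r (p x) ≤ cnt p (p x) ins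

  basis-spec : ∀ B N L → (∀ v → wt v B + wt v N + wt v L ≡ wt v V) → (∀ i → cnt p i B ≤ r i) →
    (∀ {x} → x ∈ N → r (p x) ≤ cnt p (p x) B) → Basis (basis B N L) (length L)
  basis-spec B N [] e h s = record
    { ins = B ; outs = N ; runs = refl ; total = λ v → trans (sym (+-identityʳ _)) (e v) ; bounded = h ; spanning = s }
  basis-spec B N (x ∷ L) e h s = go (cnt p (p x) B <ᵇ r (p x)) refl
    where
    reorder : ∀ x b n l → x + b + n + l ≡ b + n + (x + l)
    reorder = solve-∀
    reorder₂ : ∀ x b n l → b + (x + n) + l ≡ b + n + (x + l)
    reorder₂ = solve-∀
    e₁ : ∀ v → b2n (v x) + wt v B + wt v N + wt v L ≡ wt v V
    e₁ v = trans (reorder (b2n (v x)) (wt v B) (wt v N) (wt v L)) (e v)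
    fr : Runs f (free? x B) (cnt p (p x) B <ᵇ r (p x)) 1
    fr = free?-runs x B (sub λ v → ≤-trans (m≤m+n _ (wt v N)) (≤-trans (m≤m+n _ (wt v L)) (≤-reflexive (e₁ v)))) h
    go : ∀ b → (cnt p (p x) B <ᵇ r (p x)) ≡ b → Basis (basis B N (x ∷ L)) (suc (length L))
    go true eb = record
      { ins = I.ins ; outs = I.outs ; total = I.total ; bounded = I.bounded ; spanning = I.spanning
      ; runs = runs-if (free? x B) (subst (λ b → Runs f (free? x B) b 1) eb fr) I.runs }
      where
      h′ : ∀ i → cnt p i (x ∷ B) ≤ r i
      h′ i with p x ≟ i
      ... | yes refl = <ᵇ-true⁻ eb
      ... | no _     = h i
      module I = Basis (basis-spec (x ∷ B) N L e₁ h′ (λ i → ≤-trans (s i) (m≤n+m _ _)))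
    go false eb = record
      { ins = I.ins ; outs = I.outs ; total = I.total ; bounded = I.bounded ; spanning = I.spanning
      ; runs = runs-if (free? x B) (subst (λ b → Runs f (free? x B) b 1) eb fr) I.runs }
      where
      spanned : ∀ {z} → z ∈ x ∷ N → r (p z) ≤ cnt p (p z) B
      spanned (here refl) = <ᵇ-false⁻ eb
      spanned (there i)   = s i
      module I = Basis (basis-spec B (x ∷ N) L
        (λ v → trans (reorder₂ (b2n (v x)) (wt v B) (wt v N) (wt v L)) (e v)) h spanned)

  search-spec : ∀ d y W H Z → y ∷ W ⊑ V → (∀ i → cnt p i W ≤ r i) → cnt p (p y) W ≡ r (p y) →
    (∀ v → wt v H + wt v Z ≡ wt v W) → 1 ≤ cnt p (p y) H → length H ≤ 2 ^ d →
    ∃[ x ] ∃[ Z′ ] (Runs f (search d y H Z) (x ∷ [] , Z′) d × p x ≡ p y × (∀ v → b2n (v x) + wt v Z′ ≡ wt v W))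
  search-spec zero y W [] Z u h full e () short
  search-spec zero y W (x ∷ x′ ∷ H) Z u h full e has (s≤s ())
  search-spec zero y W (x ∷ []) Z u h full e has short with wt-find (λ z → ⌊ p z ≟ p y ⌋) (x ∷ []) has
  ... | _ , here refl , ex = x , Z , refl , ⌊≟⌋-≡ ex , λ v → trans (cong (_+ wt v Z) (sym (+-identityʳ _))) (e v)
  search-spec (suc d) y W H Z u h full e has short = go _ refl
    where
    H₁ H₂ : List (Fin n)
    H₁ = take (2 ^ d) H
    H₂ = drop (2 ^ d) H
    split : ∀ v → wt v H₁ + wt v H₂ ≡ wt v H
    split v = trans (sym (wt-++ v H₁ H₂)) (cong (wt v) (take++drop≡id (2 ^ d) H))
    e₁ : ∀ v → wt v H₁ + wt v (H₂ ++ Z) ≡ wt v W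
    e₁ v = trans (cong (wt v H₁ +_) (wt-++ v H₂ Z)) (trans (sym (+-assoc (wt v H₁) _ _)) (trans (cong (_+ wt v Z) (split v)) (e v)))
    e₂ : ∀ v → wt v H₂ + wt v (H₁ ++ Z) ≡ wt v W
    e₂ v = trans (cong (wt v H₂ +_) (wt-++ v H₁ Z)) (trans (sym (+-assoc (wt v H₂) _ _))
      (trans (cong (_+ wt v Z) (trans (+-comm (wt v H₂) _) (split v))) (e v)))
    c : List (Fin n) → ℕ
    c = cnt p (p y)
    S⊑W : H₂ ++ Z ⊑ W
    S⊑W = sub λ v → ≤-trans (m≤n+m _ (wt v H₁)) (≤-reflexive (e₁ v))
    fr : Runs f (free? y (H₂ ++ Z)) (c (H₂ ++ Z) <ᵇ r (p y)) 1
    fr = free?-runs y (H₂ ++ Z) (sub λ v → ≤-trans (+-monoʳ-≤ (b2n (v y)) (wt-≤ S⊑W v)) (wt-≤ u v)) (λ i → ≤-trans (wt-≤ S⊑W _) (h i))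
    H₁-none : (c (H₂ ++ Z) <ᵇ r (p y)) ≡ false → c H₁ ≡ 0
    H₁-none eb = n≤0⇒n≡0 (+-cancelʳ-≤ (c (H₂ ++ Z)) _ 0 (≤-trans (≤-reflexive (trans (e₁ _) full)) (<ᵇ-false⁻ eb)))
    go : ∀ b → (c (H₂ ++ Z) <ᵇ r (p y)) ≡ b →
      ∃[ x ] ∃[ Z′ ] (Runs f (search (suc d) y H Z) (x ∷ [] , Z′) (suc d) × p x ≡ p y × (∀ v → b2n (v x) + wt v Z′ ≡ wt v W))
    go true eb with search-spec d y W H₁ (H₂ ++ Z) u h full e₁
      (+-cancelʳ-≤ (c (H₂ ++ Z)) 1 _ (≤-trans (<ᵇ-true⁻ eb) (≤-reflexive (trans (sym full) (sym (e₁ _))))))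
      (≤-trans (≤-reflexive (length-take (2 ^ d) H)) (m⊓n≤m (2 ^ d) _))
    ... | x , Z′ , ru , px , eq = x , Z′ , runs-if (free? y (H₂ ++ Z)) (subst (λ b → Runs f (free? y (H₂ ++ Z)) b 1) eb fr) ru , px , eq
    go false eb with search-spec d y W H₂ (H₁ ++ Z) u h full e₂
      (≤-trans has (≤-reflexive (trans (sym (split _)) (cong (_+ c H₂) (H₁-none eb)))))
      (≤-trans (≤-reflexive (length-drop (2 ^ d) H)) (m≤n+o⇒m∸n≤o (length H) (2 ^ d) (≤-trans short (+-monoʳ-≤ (2 ^ d) (≤-reflexive (+-identityʳ _))))))
    ... | x , Z′ , ru , px , eq = x , Z′ , runs-if (free? y (H₂ ++ Z)) (subst (λ b → Runs f (free? y (H₂ ++ Z)) b 1) eb fr) ru , px , eq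

  -- In `cost-≤` each search of `d` queries is charged to the element that it adds to `outs`. `same`
  -- links the elements taken from the basis to those found outside it, part by part, so that room
  -- in the working basis reveals a part already served.
  record Transversal (d : ℕ) (base N Y : List (Fin n)) (m : Alg n (List (Fin n) × List (Fin n) × List (Fin n))) : Set where
    field
      core     : List (Fin n)
      ins      : List (Fin n)
      outs     : List (Fin n)
      cost     : ℕ
      runs     : Runs f m (core , ins , outs) cost
      total    : ∀ v → wt v core + wt v ins ≡ wt v base
      same     : ∀ i → cnt p i ins ≡ cnt p i outs
      indep    : Indep p outs
      keeps    : ∀ i → cnt p i Y ≤ cnt p i outs
      covered  : ∀ {y} → y ∈ N → 1 ≤ cnt p (p y) outs
      outs⊑    : outs ⊑ N ++ Y
      cost-≤   : cost + d * length Y ≤ length N + d * length outs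

  transversal-spec : ∀ d base → (∀ i → cnt p i base ≡ r i) → length base ≤ 2 ^ d →
    ∀ N B X Y → base ++ N ⊑ V → (∀ v → wt v B + wt v X ≡ wt v base) → (∀ i → cnt p i X ≡ cnt p i Y) → Indep p Y →
    Transversal d base N Y (transversal d N B X Y)
  transversal-spec d base full short [] B X Y u e same iY = record
    { core = B ; ins = X ; outs = Y ; cost = 0 ; runs = refl ; total = e ; same = same ; indep = iY
    ; keeps = λ _ → ≤-refl ; covered = λ () ; outs⊑ = ⊑-refl ; cost-≤ = ≤-refl }
  transversal-spec d base full short (y ∷ N) B X Y u e same iY = go _ refl
    where
    c : List (Fin n) → ℕ
    c = cnt p (p y)
    B⊑ : B ⊑ base
    B⊑ = sub λ v → ≤-trans (m≤m+n _ _) (≤-reflexive (e v))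
    y∷B⊑V : y ∷ B ⊑ V
    y∷B⊑V = sub λ v → ≤-trans (≤-trans (≤-reflexive (+-comm (b2n (v y)) (wt v B)))
      (+-mono-≤ (wt-≤ B⊑ v) (m≤m+n (b2n (v y)) (wt v N)))) (≤-trans (≤-reflexive (sym (wt-++ v base (y ∷ N)))) (wt-≤ u v))
    base++N⊑V : base ++ N ⊑ V
    base++N⊑V = ⊑-trans (⊑-++ ⊑-refl (sub λ v → m≤n+m _ (b2n (v y)))) u
    B≤r : ∀ i → cnt p i B ≤ r i
    B≤r i = ≤-trans (wt-≤ B⊑ _) (≤-reflexive (full i))
    fr : Runs f (free? y B) (c B <ᵇ r (p y)) 1
    fr = free?-runs y B y∷B⊑V B≤r
    c+c : c B + c X ≡ r (p y)
    c+c = trans (e _) (full (p y))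
    go : ∀ b → (c B <ᵇ r (p y)) ≡ b → Transversal d base (y ∷ N) Y (transversal d (y ∷ N) B X Y)
    go true eb = record
      { core = I.core ; ins = I.ins ; outs = I.outs ; cost = suc I.cost
      ; runs = runs-if (free? y B) (subst (λ b → Runs f (free? y B) b 1) eb fr) I.runs
      ; total = I.total ; same = I.same ; indep = I.indep ; keeps = I.keeps
      ; covered = λ { (here refl) → ≤-trans y-hit (I.keeps (p y)) ; (there i) → I.covered i }
      ; outs⊑ = ⊑-trans I.outs⊑ (sub λ v → m≤n+m _ (b2n (v y)))
      ; cost-≤ = s≤s I.cost-≤ }
      where
      module I = Transversal (transversal-spec d base full short N B X Y base++N⊑V e same iY)
      -- `base` saturates the part, so room in `B` means that an element of it has moved to `X`; by
      -- `same`, `Y` then has one too.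
      y-hit : 1 ≤ c Y
      y-hit = ≤-trans (+-cancelˡ-≤ (c B) 1 (c X) (≤-trans (≤-reflexive (+-comm (c B) 1)) (≤-trans (<ᵇ-true⁻ eb) (≤-reflexive (sym c+c)))))
        (≤-reflexive (same (p y)))
    go false eb with search-spec d y B B [] y∷B⊑V B≤r B-full (λ v → +-identityʳ _)
        (≤-trans (proj₁ (valid (p y))) (≤-reflexive (sym B-full))) (≤-trans (⊑-length B⊑) short)
      where
      B-full : c B ≡ r (p y)
      B-full = ≤-antisym (B≤r (p y)) (<ᵇ-false⁻ eb)
    ... | x , Z , ru , px , eq = record
      { core = I.core ; ins = I.ins ; outs = I.outs ; cost = suc (d + I.cost)
      ; runs = runs-if (free? y B) (subst (λ b → Runs f (free? y B) b 1) eb fr) (runs-bind (search d y B []) ru I.runs)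
      ; total = I.total ; same = I.same ; indep = I.indep
      ; keeps = λ i → ≤-trans (m≤n+m _ _) (I.keeps i)
      ; covered = λ { (here refl) → ≤-trans (≤-trans (≤-reflexive (cong b2n (sym (⌊≟⌋-refl (p y))))) (m≤m+n _ (c Y))) (I.keeps (p y)) ; (there i) → I.covered i }
      ; outs⊑ = ⊑-trans I.outs⊑ (sub λ v → ≤-reflexive (move v))
      ; cost-≤ = cost′ }
      where
      no-X : c X ≡ 0
      no-X = n≤0⇒n≡0 (+-cancelˡ-≤ (c B) _ 0 (≤-trans (≤-reflexive c+c) (≤-trans (<ᵇ-false⁻ eb) (m≤m+n _ 0))))
      total′ : ∀ v → wt v Z + (b2n (v x) + wt v X) ≡ wt v base
      total′ v = trans (lemma (wt v Z) (b2n (v x)) (wt v X)) (trans (cong (_+ wt v X) (eq v)) (e v))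
        where
        lemma : ∀ z x w → z + (x + w) ≡ x + z + w
        lemma = solve-∀
      iY′ : Indep p (y ∷ Y)
      iY′ i with p y ≟ i
      ... | yes refl = ≤-reflexive (cong suc (trans (sym (same (p y))) no-X))
      ... | no _     = iY i
      module I = Transversal (transversal-spec d base full short N Z (x ∷ X) (y ∷ Y) base++N⊑V total′
        (λ i → cong₂ (λ z w → b2n ⌊ z ≟ i ⌋ + w) px (same i)) iY′)
      move : ∀ v → wt v (N ++ y ∷ Y) ≡ b2n (v y) + wt v (N ++ Y)
      move v = trans (wt-++ v N (y ∷ Y)) (trans (+-swap (wt v N) (b2n (v y)) (wt v Y)) (cong (b2n (v y) +_) (sym (wt-++ v N Y))))
      cost′ : suc (d + I.cost) + d * length Y ≤ suc (length N) + d * length I.outs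
      cost′ = s≤s (≤-trans (≤-reflexive (lemma d I.cost (length Y))) I.cost-≤)
        where
        lemma : ∀ d c y → d + c + d * y ≡ c + d * suc y
        lemma = solve-∀

  ∸-runs : ∀ S a total → f S + a ≡ total → Runs f (ask S (λ b → done (total ∸ b))) a 1
  ∸-runs S a total e = cong (_, 1) (trans (cong (_∸ f S) (sym e)) (m+n∸m≡n (f S) a))

  contracted-runs : ∀ base D → D ++ base ⊑ V → (∀ i → cnt p i base + 1 ≡ r i) →
    ∀ T Q → T ++ Q ⊑ D → Indep p T → Indep p Q → Runs f (contracted base T Q) (wt (hit p Q) T) 1
  contracted-runs base D u full T Q h iT iQ = ∸-runs ⟦ S ⟧ _ (length S) (begin
    f ⟦ S ⟧ + wt (hit p Q) T                            ≡⟨ cong₂ _+_ (rank-⟦⟧ p r S (Uniq-⊑V (⊑-trans (⊑-++ h ⊑-refl) u))) (sym (∑-hit p T Q iQ)) ⟩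
    ∑ (λ i → cnt p i S ⊓ r i) + ∑ (λ i → cnt p i T * cnt p i Q) ≡⟨ ∑-+ (λ i → cnt p i S ⊓ r i) _ ⟨
    ∑ (λ i → cnt p i S ⊓ r i + cnt p i T * cnt p i Q)   ≡⟨ ∑-cong (λ i → trans (cong (λ z → z ⊓ r i + cnt p i T * cnt p i Q) (parts i))
                                                            (trans (⊓-contract (iT i) (iQ i) (full i)) (sym (parts i)))) ⟩
    ∑ (λ i → cnt p i S)                                 ≡⟨ ∑-cnt p S ⟩
    length S                                            ∎)
    where
    open ≡-Reasoning
    S : List (Fin n)
    S = (T ++ Q) ++ base
    parts : ∀ i → cnt p i S ≡ cnt p i T + cnt p i Q + cnt p i base
    parts i = trans (wt-++ _ (T ++ Q) base) (cong (_+ cnt p i base) (wt-++ _ T Q))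

  deleted-runs : ∀ b D → D ⊑ V → (∀ i → cnt p i D ≡ r i + 1) → ∑ r ≡ b →
    ∀ T Q → T ++ Q ⊑ D → Indep p T → Indep p Q → Runs f (deleted b D T Q) (wt (hit p Q) T) 1
  deleted-runs b D u full b≡ T Q h iT iQ = ∸-runs ⟦ S ⟧ _ b (begin
    f ⟦ S ⟧ + wt (hit p Q) T                            ≡⟨ cong₂ _+_ (rank-⟦⟧ p r S (Uniq-⊑V (⊑-trans S⊑D u))) (sym (∑-hit p T Q iQ)) ⟩
    ∑ (λ i → cnt p i S ⊓ r i) + ∑ (λ i → cnt p i T * cnt p i Q) ≡⟨ ∑-+ (λ i → cnt p i S ⊓ r i) _ ⟨
    ∑ (λ i → cnt p i S ⊓ r i + cnt p i T * cnt p i Q)   ≡⟨ ∑-cong (λ i → ⊓-delete (iT i) (iQ i) (parts i)) ⟩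
    ∑ r                                                 ≡⟨ b≡ ⟩
    b                                                   ∎)
    where
    open ≡-Reasoning
    S : List (Fin n)
    S = minus D (T ++ Q)
    S⊑D : S ⊑ D
    S⊑D = sub λ v → ≤-trans (m≤m+n _ _) (≤-reflexive (wt-minus (T ++ Q) h v))
    parts : ∀ i → cnt p i S + (cnt p i T + cnt p i Q) ≡ r i + 1
    parts i = trans (cong (cnt p i S +_) (sym (wt-++ _ T Q))) (trans (wt-minus (T ++ Q) h _) (full i))

  Learned : Output n → Set
  Learned (k′ , q , cap) = Σ (Fin k ↔ Fin k′) λ σ →
    ((x : Fin n) → q x ≡ Inverse.to σ (p x)) × ((i : Fin k) → cap (Inverse.to σ i) ≡ r i)

  witness : ∀ i → ∃[ x ] p x ≡ i
  witness i with wt-find (λ x → ⌊ p x ≟ i ⌋) V (≤-trans (≤-trans (proj₁ (valid i)) (<⇒≤ (proj₂ (valid i)))) (≤-reflexive (sym (cnt-V i))))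
  ... | x , _ , e = x , ⌊≟⌋-≡ e

  -- `from` reads the class off a representative, whereas `to` needs a sample element of the class;
  -- independence of `R` makes them inverse.
  assemble-spec : ∀ R ρ B → Indep p R → (∀ x → p (ρ x) ≡ p x) → (∀ x → ρ x ∈ R) → (∀ i → cnt p i B ≡ r i) →
    Learned (assemble R ρ B)
  assemble-spec R ρ B iR pρ ρ∈ full with all? (λ x → any? (ρ x ≟_) R)
  ... | no nh = ⊥-elim (nh ρ∈)
  ... | yes h = mk↔ₛ′ to from to-from from-to , q≡ , caps
    where
    q : Fin n → Fin (length R)
    q x = index (h x)
    from : Fin (length R) → Fin k
    from a = p (lookup R a)
    from-q : ∀ x → from (q x) ≡ p x
    from-q x = trans (cong p (sym (lookup-index (h x)))) (pρ x)
    to : Fin k → Fin (length R)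
    to i = q (proj₁ (witness i))
    from-to : ∀ i → from (to i) ≡ i
    from-to i = trans (from-q _) (proj₂ (witness i))
    to-from : ∀ a → to (from a) ≡ a
    to-from a = lookup-injective p R iR _ a (from-to (from a))
    q≡ : ∀ x → q x ≡ to (p x)
    q≡ x = lookup-injective p R iR _ _ (trans (from-q x) (sym (from-to (p x))))
    caps : ∀ i → wt (λ x → ⌊ q x ≟ to i ⌋) B ≡ r i
    caps i = trans (wt-cong (λ x → ⇔⇒≡
        (λ e → trans (cong (λ z → ⌊ z ≟ i ⌋) (trans (sym (from-q x)) (trans (cong from (⌊≟⌋-≡ e)) (from-to i)))) (⌊≟⌋-refl i))
        (λ e → trans (cong (λ z → ⌊ z ≟ to i ⌋) (trans (q≡ x) (cong to (⌊≟⌋-≡ e)))) (⌊≟⌋-refl (to i)))) B)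
      (full i)

  rank-⊤ : f ⊤ ≡ ∑ r
  rank-⊤ = ∑-cong λ i → trans (cong (λ S → ∣ S ∣ ⊓ r i) (∩-identityˡ (Part p i))) (m≥n⇒m⊓n≡n (<⇒≤ (proj₂ (valid i))))

  -- Combining the stages and counting the queries

  module FromBasis (I : Basis (basis [] [] V) (length V)) where

    private module I = Basis I
    B N : List (Fin n)
    B = I.ins
    N = I.outs
    -- The strict inequality `r i < |P_i|` leaves an element of every part outside the basis; it
    -- yields the transversal `Y`.
    cnt-N : ∀ i → 1 ≤ cnt p i N
    cnt-N i = +-cancelˡ-≤ (cnt p i B) 1 _ (begin
      cnt p i B + 1               ≡⟨ +-comm (cnt p i B) 1 ⟩
      suc (cnt p i B)             ≤⟨ s≤s (I.bounded i) ⟩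
      suc (r i)                   ≤⟨ proj₂ (valid i) ⟩
      ∣ Part p i ∣                ≡⟨ cnt-V i ⟨
      cnt p i V                   ≡⟨ I.total _ ⟨
      cnt p i B + cnt p i N       ∎)
      where open ≤-Reasoning
    outer : ∀ i → ∃[ y ] (y ∈ N × p y ≡ i)
    outer i with wt-find (λ x → ⌊ p x ≟ i ⌋) N (cnt-N i)
    ... | y , y∈ , e = y , y∈ , ⌊≟⌋-≡ e
    -- An element of part `i` outside the basis was rejected, which happens only when the part is
    -- saturated.
    full : ∀ i → cnt p i B ≡ r i
    full i with outer i
    ... | y , y∈ , refl = ≤-antisym (I.bounded i) (I.spanning y∈)
    d : ℕ
    d = ⌈log₂ length B ⌉
    B++N⊑V : B ++ N ⊑ V
    B++N⊑V = sub λ v → ≤-reflexive (trans (wt-++ v B N) (I.total v))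

    module FromTransversal (X : Transversal d B N [] (transversal d N B [] [])) where

      private module X = Transversal X
      outs⊑N : X.outs ⊑ N
      outs⊑N = subst (X.outs ⊑_) (++-identityʳ N) X.outs⊑
      cnt-outs : ∀ i → cnt p i X.outs ≡ 1
      cnt-outs i with outer i
      ... | y , y∈ , refl = ≤-antisym (X.indep i) (X.covered y∈)
      D₁ D₂ : List (Fin n)
      D₁ = X.ins ++ N
      D₂ = B ++ X.outs
      D₁⊑V : D₁ ++ X.core ⊑ V
      D₁⊑V = sub λ v → ≤-reflexive (begin
        wt v (D₁ ++ X.core)                         ≡⟨ trans (wt-++ v D₁ X.core) (cong (_+ wt v X.core) (wt-++ v X.ins N)) ⟩
        wt v X.ins + wt v N + wt v X.core           ≡⟨ lemma (wt v X.ins) (wt v N) (wt v X.core) ⟩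
        wt v X.core + wt v X.ins + wt v N           ≡⟨ cong (_+ wt v N) (X.total v) ⟩
        wt v B + wt v N                             ≡⟨ I.total v ⟩
        wt v V                                      ∎)
        where
        open ≡-Reasoning
        lemma : ∀ a b c → a + b + c ≡ c + a + b
        lemma = solve-∀
      cnt-core : ∀ i → cnt p i X.core + 1 ≡ r i
      cnt-core i = trans (cong (cnt p i X.core +_) (sym (trans (X.same i) (cnt-outs i)))) (trans (X.total _) (full i))
      D₂⊑V : D₂ ⊑ V
      D₂⊑V = ⊑-trans (⊑-++ ⊑-refl outs⊑N) B++N⊑V
      cnt-D₂ : ∀ i → cnt p i D₂ ≡ r i + 1
      cnt-D₂ i = trans (wt-++ _ B X.outs) (cong₂ _+_ (full i) (cnt-outs i))
      ∑r : ∑ r ≡ length B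
      ∑r = trans (∑-cong (λ i → sym (full i))) (∑-cnt p B)
      module C₁ = Merging f p D₁ (contracted X.core) (contracted-runs X.core D₁ D₁⊑V cnt-core)
      module C₂ = Merging f p D₂ (deleted (length B) D₂) (deleted-runs (length B) D₂ D₂⊑V cnt-D₂ ∑r)

      module FromPartitions (P : C₁.Partitioned D₁ (partition (contracted X.core) D₁))
        (Q : C₂.Partitioned D₂ (partition (deleted (length B) D₂) D₂)) where

        private
          module P = C₁.Partitioned P
          module Q = C₂.Partitioned Q
        ρ : Fin n → Fin n
        ρ = link B X.outs P.move Q.move
        -- The second partition sends `x` and the element of `Y` in its part to the same
        -- representative, since its representatives are independent. The lookup therefore succeeds,
        -- and whatever it returns lies in the part of `x`.
        linked : ∀ x → x ∈ B → preimage Q.move X.outs (Q.move x) ∈ X.outs × p (preimage Q.move X.outs (Q.move x)) ≡ p x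
        linked x x∈ with wt-find (λ y → ⌊ p y ≟ p x ⌋) X.outs (≤-reflexive (sym (cnt-outs (p x))))
        ... | y , y∈ , e with preimage-spec Q.move X.outs y∈
                              (Indep-unique p Q.indep (Q.covers (∈-++⁺ʳ B y∈)) (Q.covers (∈-++⁺ˡ x∈))
                                (trans (Q.move-p y) (trans (⌊≟⌋-≡ e) (sym (Q.move-p x)))))
        ...   | z∈ , e′ = z∈ , trans (sym (Q.move-p _)) (trans (cong p e′) (Q.move-p x))
        pρ : ∀ x → p (ρ x) ≡ p x
        pρ x with hit id B x in eh
        ... | true  = trans (P.move-p _) (proj₂ (linked x (hit-id⁻ B eh)))
        ... | false = P.move-p x
        ρ∈ : ∀ x → ρ x ∈ P.reps
        ρ∈ x with hit id B x in eh
        ... | true  = P.covers (∈-++⁺ʳ X.ins (⊑⇒⊆ outs⊑N (proj₁ (linked x (hit-id⁻ B eh)))))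
        ... | false = P.covers (∈-++⁺ʳ X.ins (hit-id⁻ N (0<ᵇ-true (≤-reflexive (sym (trans (sym (cong (_+ cnt id x N) (0<ᵇ-false⁻ eh)))
                        (trans (I.total _) (mult-allFin x))))))))
        runs : Runs f (learn n) (assemble P.reps ρ B) (length V + (X.cost + (P.cost + (Q.cost + 0))))
        runs = runs-bind (basis [] [] V) I.runs (runs-bind (transversal d N B [] []) X.runs
          (runs-bind (partition (contracted X.core) D₁) P.runs (runs-bind (partition (deleted (length B) D₂) D₂) Q.runs refl)))
        |V| : length V ≡ n
        |V| = length-tabulate id
        |B|+|N| : length B + length N ≡ n
        |B|+|N| = trans (sym (cong₂ _+_ (wt-true B) (wt-true N))) (trans (I.total _) (trans (wt-true V) |V|))
        |D₁| : length D₁ ≤ n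
        |D₁| = ≤-trans (⊑-length (⊑-trans (⊑-++ˡ D₁ X.core) D₁⊑V)) (≤-reflexive |V|)
        |D₂| : length D₂ ≤ n
        |D₂| = ≤-trans (⊑-length D₂⊑V) (≤-reflexive |V|)
        |outs| : length X.outs ≤ k
        |outs| = ≤-trans (≤-reflexive (sym (∑-cnt p X.outs))) (≤-trans (∑-mono X.indep) (≤-reflexive ∑-1))
        |N| : length N ≤ n
        |N| = ≤-trans (m≤n+m _ (length B)) (≤-reflexive |B|+|N|)
        d≡ : d ≡ ⌈log₂ f ⊤ ⌉
        d≡ = cong ⌈log₂_⌉ (trans (sym ∑r) (sym rank-⊤))
        X-cost : X.cost ≤ n + d * k
        X-cost = ≤-trans (m≤m+n _ _) (≤-trans X.cost-≤ (+-mono-≤ |N| (*-monoʳ-≤ d |outs|)))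
        -- Per element there are one query for the basis, at most one test in `transversal`, and 452
        -- for each of two partitions, so `2 + 2 * 452 = 906`. The searches contribute `k * d` once;
        -- the summand `905 * (k * d)` only brings both terms to the same constant.
        cost-≤ : length V + (X.cost + (P.cost + (Q.cost + 0))) ≤ 906 * (n + k * ⌈log₂ f ⊤ ⌉)
        cost-≤ = begin
          length V + (X.cost + (P.cost + (Q.cost + 0)))
            ≤⟨ +-mono-≤ (≤-reflexive |V|) (+-mono-≤ X-cost (+-mono-≤ (≤-trans P.cost-≤ (*-monoʳ-≤ 452 |D₁|))
                 (+-monoˡ-≤ 0 (≤-trans Q.cost-≤ (*-monoʳ-≤ 452 |D₂|))))) ⟩
          n + ((n + d * k) + (452 * n + (452 * n + 0)))    ≤⟨ m≤m+n _ (905 * (k * d)) ⟩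
          n + ((n + d * k) + (452 * n + (452 * n + 0))) + 905 * (k * d) ≡⟨ lemma n d k ⟩
          906 * (n + k * d)                                ≡⟨ cong (λ z → 906 * (n + k * z)) d≡ ⟩
          906 * (n + k * ⌈log₂ f ⊤ ⌉)                      ∎
          where
          open ≤-Reasoning
          lemma : ∀ n d k → n + ((n + d * k) + (452 * n + (452 * n + 0))) + 905 * (k * d) ≡ 906 * (n + k * d)
          lemma = solve-∀


        learned : Learned (assemble P.reps ρ B)
        learned = assemble-spec P.reps ρ B P.indep pρ ρ∈ full

  Learns : Set
  Learns = Σ (Output n) λ o → Σ ℕ λ c → Runs f (learn n) o c × Learned o × c ≤ 906 * (n + k * ⌈log₂ f ⊤ ⌉)

  learn-spec : Learns
  learn-spec = from-basis (basis-spec [] [] V (λ _ → refl) (λ _ → z≤n) (λ ()))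
    where
    from-basis : Basis (basis [] [] V) (length V) → Learns
    from-basis I = from-transversal
      (transversal-spec d B full (≤2^⌈log₂⌉ (length B)) N B [] [] B++N⊑V (λ _ → +-identityʳ _) (λ _ → refl) (λ _ → z≤n))
      where
      open FromBasis I
      from-transversal : Transversal d B N [] (transversal d N B [] []) → Learns
      from-transversal X = from-partitions (C₁.partition-spec D₁ ⊑-refl) (C₂.partition-spec D₂ ⊑-refl)
        where
        open FromTransversal X
        from-partitions : C₁.Partitioned D₁ _ → C₂.Partitioned D₂ _ → Learns
        from-partitions P Q = _ , _ , runs , learned , cost-≤
          where open FromPartitions P Q

theorem2 : Σ ((n : ℕ) → Alg n (Output n)) (λ A →
               Σ ℕ (λ C →
                 (n k : ℕ) (p : Fin n → Fin k) (r : Fin k → ℕ) → ValidCaps p r →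
                   let res = run (A n) (rank p r)
                       out = proj₁ res
                       k′ = proj₁ out
                       q = proj₁ (proj₂ out)
                       cap = proj₂ (proj₂ out)
                   in Σ (Fin k ↔ Fin k′) (λ σ →
                        ((x : Fin n) → q x ≡ Inverse.to σ (p x))
                        × ((i : Fin k) → cap (Inverse.to σ i) ≡ r i))
                      × (proj₂ res ≤ C * (n + k * ⌈log₂ rank p r ⊤ ⌉))))
theorem2 = learn , 906 , λ n k p r valid →
  let open Learning p r valid
      (o , c , runs , learned , bound) = learn-spec
  in subst Learned (sym (cong proj₁ runs)) learned , subst (_≤ 906 * (n + k * ⌈log₂ f ⊤ ⌉)) (sym (cong proj₂ runs)) bound
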